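{- For any partition $\rho$ (written $\rho=(\rho_1,\dots,\rho_{\ell(\rho)})$) and any positive integers $k,m$, one has $$a^{k}_{\rho \cup (m)} = \delta_{m,1}\, a^k_{\rho} +\sum_{1 \leq i \leq \ell(\rho)} \rho_i\, a^{k-1}_{\rho \setminus (\rho_{i}) \cup (\rho_{i}+m)} + \sum_{\substack{r+s=m \\ r,s \geq 1}} a^{k-1}_{\rho \cup (r,s)},$$ where the last sum runs over ordered pairs $(r,s)$ of positive integers with $r+s=m$.
   Context: A partition $\lambda$ of $n\ge 0$ (written $\lambda\vdash n$) is a non-increasing finite sequence of positive integers (parts) with sum $n=|\lambda|$; $\ell(\lambda)$ is its number of parts. $\lambda\setminus(i)$ is the partition obtained by erasing one part equal to $i$, and $\lambda\cup(i)$, $\lambda\cup(i,j)$ are obtained by adding a part $i$, respectively parts $i$ and $j$ (and reordering). $\delta_{m,1}$ is the Kronecker delta. In the group algebra $\mathbb{Z}[S_n]$ of the symmetric group, the Jucys-Murphy elements are $J_i=\sum_{j<i}(j\ i)$ for $1\le i\le n$ (so $J_1=0$). They commute with each other, and any symmetric function evaluated in $J_1,\dots,J_n$ is central in $\mathbb{Z}[S_n]$. Let $\mathcal{C}_\lambda$ be the sum of all permutations in $S_n$ of cycle-type $\lambda$. Let $h_k$ denote the complete homogeneous symmetric function of degree $k$ ($h_0=1$). The integers $a^k_\lambda$ ($k\ge 0$, $\lambda$ a partition) are defined by $$h_k(J_1,\dots,J_n)=\sum_{\lambda\vdash n}a^k_\lambda\,\mathcal{C}_\lambda\qquad (n\ge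 0).$$ For $n=0$ (the trivial group, no variables), this means $a^k_\emptyset=\delta_{k,0}$. -}

module Defs where

open import Data.Bool.Base using (if_then_else_)
open import Data.Fin.Base as Fin using (Fin; toℕ)
import Data.Fin.Properties as Fin
open import Data.Fin.Permutation as Perm using (Permutation′; _⟨$⟩ʳ_; _∘ₚ_; transpose)
open import Data.Integer.Base as ℤ using (ℤ; +_; 0ℤ; 1ℤ)
open import Data.List.Base as List
  using (List; []; _∷_; [_]; _++_; concatMap; filter; length; removeAt;
         cartesianProductWith; mapMaybe; foldr; allFin; downFrom; upTo)
open import Data.List.Membership.Propositional using (_∈_)
open import Data.List.Membership.Propositional.Properties using (∈-filter⁺; ∈-allFin)
open import Data.List.Properties using (≡-dec)
open import Data.List.Relation.Binary.Permutation.Propositional using (↭-sym)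
open import Data.List.Relation.Binary.Permutation.Propositional.Properties using (All-resp-↭)
open import Data.List.Relation.Unary.All using (All; []; _∷_; all?; universal)
open import Data.List.Relation.Unary.All.Properties using (map⁺)
open import Data.List.Relation.Unary.Linked using (Linked; linked?)
open import Data.List.Sort.Base using (module SortingAlgorithm)
import Data.List.Sort.InsertionSort as InsertionSort
open import Data.Maybe.Base as Maybe using (Maybe)
open import Data.Nat.Base as ℕ using (ℕ; zero; suc; NonZero; _≥_)
open import Data.Nat.GeneralisedArithmetic using (fold)
open import Data.Nat.ListAction using (sum)
import Data.Nat.Properties as ℕ
open import Data.Product.Base using (∃; _×_; _,_)
open import Relation.Binary.Definitions using (DecidableEquality)
import Relation.Binary.Construct.Flip.EqAndOrd as Flip
open import Relation.Binary.PropositionalEquality using (_≡_; refl; cong)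
open import Relation.Nullary.Decidable using (Dec; does; map′; dec⇒maybe; _×-dec_; _→-dec_)

------------------------------------------------------------------------
-- Integer partitions

record Partition : Set where
  constructor partition
  field
    parts     : List ℕ
    .sorted   : Linked _≥_ parts
    .positive : All NonZero parts

open Partition public

∣_∣ : Partition → ℕ
∣ ρ ∣ = sum (parts ρ)

ℓ : Partition → ℕ
ℓ ρ = length (parts ρ)

part : (ρ : Partition) → Fin (ℓ ρ) → ℕ
part ρ = List.lookup (parts ρ)

infix 4 _≟_

_≟_ : DecidableEquality Partition
partition xs _ _ ≟ partition ys _ _ =
  map′ (λ { refl → refl }) (cong parts) (≡-dec ℕ._≟_ xs ys)

≥-decTotalOrder = Flip.decTotalOrder ℕ.≤-decTotalOrder

open InsertionSort ≥-decTotalOrder using (insertionSort)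
open SortingAlgorithm insertionSort using (sort; sort-↭; sort-↗)

fromList : (xs : List ℕ) → .(All NonZero xs) → Partition
fromList xs pos =
  partition (sort xs) (sort-↗ xs) (All-resp-↭ (↭-sym (sort-↭ xs)) pos)

infixl 6 _∪_ _∖_

_∪_ : Partition → (m : ℕ) .{{_ : NonZero m}} → Partition
_∪_ (partition xs _ pos) m {{m≢0}} = fromList (m ∷ xs) (m≢0 ∷ pos)

removeAt⁺ : ∀ {xs : List ℕ} (i : Fin (length xs)) →
            All NonZero xs → All NonZero (removeAt xs i)
removeAt⁺ Fin.zero    (_ ∷ ps) = ps
removeAt⁺ (Fin.suc i) (p ∷ ps) = p ∷ removeAt⁺ i ps

-- ρ ∖ i erases the part ρᵢ; the argument is its index, not its value.
_∖_ : (ρ : Partition) → Fin (ℓ ρ) → Partition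
partition xs _ pos ∖ i = fromList (removeAt xs i) (removeAt⁺ i pos)

+-nonZeroʳ : ∀ a m .{{_ : NonZero m}} → NonZero (a ℕ.+ m)
+-nonZeroʳ zero    (suc m) = _
+-nonZeroʳ (suc a) (suc m) = _

δ : ℕ → ℕ → ℤ
δ m n = if does (m ℕ.≟ n) then 1ℤ else 0ℤ

------------------------------------------------------------------------
-- Monomials and the complete homogeneous symmetric functions

-- The words xᵢ₁ xᵢ₂ ⋯ xᵢₖ with i₁ ≤ i₂ ≤ ⋯ ≤ iₖ in the letters x₁, …, xₙ,
-- each index sequence listed once: these are the monomials of degree k.
monomials : ∀ {A : Set} → ℕ → List A → List (List A)
monomials zero    xs       = [] ∷ []
monomials (suc k) []       = []
monomials (suc k) (x ∷ xs) =
  List.map (x ∷_) (monomials k (x ∷ xs)) ++ monomials (suc k) xs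

asPartition : List ℕ → Maybe Partition
asPartition xs =
  Maybe.map (λ (s , p) → partition xs s p)
            (dec⇒maybe (linked? ℕ._≥?_ xs ×-dec all? ℕ.nonZero? xs))

-- All λ ⊢ n, each exactly once: a partition of n has at most n parts, and its
-- parts form a weakly decreasing word in the letters n, n-1, …, 0.
partitions : ℕ → List Partition
partitions n =
  filter (λ ρ → ∣ ρ ∣ ℕ.≟ n)
    (mapMaybe asPartition
      (concatMap (λ l → monomials l (downFrom (suc n))) (upTo (suc n))))

------------------------------------------------------------------------
-- The symmetric group Sₙ

-- Perm._∘ₚ_ composes from left to right; this is the usual product of functions.
infixl 7 _·_

_·_ : ∀ {n} → Permutation′ n → Permutation′ n → Permutation′ n
σ · τ = τ ∘ₚ σ

_≈?_ : ∀ {n} (σ τ : Permutation′ n) → Dec (σ Perm.≈ τ)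
σ ≈? τ = Fin.all? (λ i → (σ ⟨$⟩ʳ i) Fin.≟ (τ ⟨$⟩ʳ i))

-- Each element of Sₙ exactly once, up to Perm._≈_.
permutations : ∀ n → List (Permutation′ n)
permutations zero    = [ Perm.id ]
permutations (suc n) =
  cartesianProductWith (Perm.insert Fin.zero) (allFin (suc n)) (permutations n)

-- j = σᵏ(i) for some k; exponents below n suffice, since cycles have length ≤ n.
SameCycle : ∀ {n} → Permutation′ n → Fin n → Fin n → Set
SameCycle {n} σ i j = ∃ λ (k : Fin n) → fold i (σ ⟨$⟩ʳ_) (toℕ k) ≡ j

sameCycle? : ∀ {n} (σ : Permutation′ n) i j → Dec (SameCycle σ i j)
sameCycle? σ i j = Fin.any? (λ k → fold i (σ ⟨$⟩ʳ_) (toℕ k) Fin.≟ j)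

cycle : ∀ {n} → Permutation′ n → Fin n → List (Fin n)
cycle {n} σ i = filter (sameCycle? σ i) (allFin n)

LeastInCycle : ∀ {n} → Permutation′ n → Fin n → Set
LeastInCycle σ i = ∀ j → SameCycle σ i j → i Fin.≤ j

leastInCycle? : ∀ {n} (σ : Permutation′ n) i → Dec (LeastInCycle σ i)
leastInCycle? σ i = Fin.all? (λ j → sameCycle? σ i j →-dec (i Fin.≤? j))

-- Each cycle is represented by its least element; fixed points are cycles.
cycleLengths : ∀ {n} → Permutation′ n → List ℕ
cycleLengths {n} σ =
  List.map (λ i → length (cycle σ i)) (filter (leastInCycle? σ) (allFin n))

cycleLengths-positive : ∀ {n} (σ : Permutation′ n) → All NonZero (cycleLengths σ)
cycleLengths-positive {n} σ = map⁺ (universal cycle≢[] _)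
  where
  ∈⇒nonZero : ∀ {i : Fin n} {xs} → i ∈ xs → NonZero (length xs)
  ∈⇒nonZero {xs = _ ∷ _} _ = _

  sameCycle-refl : ∀ {n} (σ : Permutation′ n) i → SameCycle σ i i
  sameCycle-refl {suc n} σ i = Fin.zero , refl

  cycle≢[] : ∀ i → NonZero (length (cycle σ i))
  cycle≢[] i = ∈⇒nonZero (∈-filter⁺ (sameCycle? σ i) (∈-allFin i) (sameCycle-refl σ i))

cycleType : ∀ {n} → Permutation′ n → Partition
cycleType σ = fromList (cycleLengths σ) (cycleLengths-positive σ)

------------------------------------------------------------------------
-- The group algebra ℤ[Sₙ]

-- Formal ℤ-linear combinations of permutations, with repetitions allowed;
-- equality in ℤ[Sₙ] is _≋_, equality of all coefficients.
ℤ[S_] : ℕ → Set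
ℤ[S n ] = List (ℤ × Permutation′ n)

coeff : ∀ {n} → Permutation′ n → ℤ[S n ] → ℤ
coeff σ = foldr (λ (c , τ) s → (if does (τ ≈? σ) then c else 0ℤ) ℤ.+ s) 0ℤ

infix 4 _≋_

_≋_ : ∀ {n} → ℤ[S n ] → ℤ[S n ] → Set
x ≋ y = ∀ σ → coeff σ x ≡ coeff σ y

sumOf : ∀ {n} → List (Permutation′ n) → ℤ[S n ]
sumOf = List.map (1ℤ ,_)

infixl 7 _⊛_ _•_

_⊛_ : ∀ {n} → ℤ[S n ] → ℤ[S n ] → ℤ[S n ]
_⊛_ = cartesianProductWith (λ (c , σ) (d , τ) → c ℤ.* d , σ · τ)

one : ∀ {n} → ℤ[S n ]
one = sumOf [ Perm.id ]

_•_ : ∀ {n} → ℤ → ℤ[S n ] → ℤ[S n ]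
c • x = List.map (λ (d , σ) → c ℤ.* d , σ) x

-- ∑[ x ∈ xs ] f x in ℤ[Sₙ]; addition of formal combinations is concatenation.
∑ : ∀ {n} {A : Set} → List A → (A → ℤ[S n ]) → ℤ[S n ]
∑ xs f = concatMap f xs

h : ∀ {n} → ℕ → List ℤ[S n ] → ℤ[S n ]
h k xs = ∑ (monomials k xs) (foldr _⊛_ one)

JM : ∀ {n} → Fin n → ℤ[S n ]
JM {n} i = sumOf (List.map (λ j → transpose j i) (filter (Fin._<? i) (allFin n)))

𝒞 : ∀ n → Partition → ℤ[S n ]
𝒞 n ρ = sumOf (filter (λ σ → cycleType σ ≟ ρ) (permutations n))

-- a k ρ plays the role of a^k_ρ. The family a is determined by this equation,
-- which has a solution because each h k (J₁, …, Jₙ) is central.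
IsCoefficientFamily : (ℕ → Partition → ℤ) → Set
IsCoefficientFamily a =
  ∀ n k → h k (List.map JM (allFin n)) ≋ ∑ (partitions n) (λ ρ → a k ρ • 𝒞 n ρ)

{-# OPTIONS --safe #-}

-- The monomials of h_k(J₁, …, J_n) whose last letter is J_n give
--   h_k(J₁, …, J_n) = h_k(J₁, …, J_{n-1}) + h_{k-1}(J₁, …, J_n) J_n.
-- Compare coefficients at a permutation σ of cycle type ρ ∪ (m) with n in the
-- cycle of length m. The first summand lives on S_{n-1}, so it contributes only
-- if σ fixes n, that is, m = 1. In the second one the coefficient is the sum over
-- j < n of the coefficients of h_{k-1}(J₁, …, J_n) at σ (j n): if j lies in
-- another cycle, the product joins the two cycles, and otherwise it splits the
-- cycle of n in two.
module Submission where

import Algebra.Properties.CommutativeSemigroup as CommutativeSemigroup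
open import Data.Bool.Base using (true; false; if_then_else_)
open import Data.Empty using (⊥; ⊥-elim-irr)
open import Data.Fin.Base as Fin using (Fin; toℕ; fromℕ; fromℕ<; inject₁; opposite; punchIn)
open import Data.Fin.Permutation as Perm
  using (Permutation′; _⟨$⟩ʳ_; transpose; insert; remove; insert-punchIn; insert-remove)
import Data.Fin.Properties as Fin
open import Data.Fin.Relation.Unary.Top using (view; ‵fromℕ; ‵inject₁)
open import Data.Integer.Base as ℤ using (ℤ; 0ℤ; 1ℤ; +_; _+_; _*_)
open import Data.Integer.Properties
  using (+-0-commutativeMonoid; +-commutativeSemigroup; +-identityˡ; +-identityʳ; +-assoc;
         +-comm; *-identityˡ; *-identityʳ; *-zeroˡ; *-zeroʳ; *-assoc; *-distribˡ-+; suc-*)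
open import Algebra.Properties.CommutativeMonoid.Sum +-0-commutativeMonoid
  using (sum-syntax; sum-cong-≗)
open import Data.List.Base hiding (partition; sum)
open import Data.List.Extrema using (min; argmin-sel; min≤xs; min≤⊤)
open import Data.List.Membership.Propositional using (_∈_; _∉_)
open import Data.List.Membership.Propositional.Properties
  using (∈-∃++; ∈-map⁺; ∈-map⁻; ∈-++⁺ˡ; ∈-++⁺ʳ; ∈-++⁻; ∈-concat⁺′; ∈-upTo⁺; ∈-allFin)
open import Data.List.Properties
  using (map-++; map-∘; map-cong; map-tabulate; length-map; length-++; length-tabulate;
         ++-identityʳ; ++-assoc; ∷-injectiveʳ; concat-map; filter-++; filter-all;
         filter-none; filter-accept; filter-reject)
open import Data.List.Relation.Binary.Disjoint.Propositional using (Disjoint)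
open import Data.List.Relation.Binary.Equality.Propositional using (≋⇒≡)
open import Data.List.Relation.Binary.Permutation.Propositional as ↭
  using (_↭_; ↭-refl; ↭-reflexive; ↭-sym; ↭-trans; ↭⇒↭ₛ; module PermutationReasoning)
open import Data.List.Relation.Binary.Permutation.Propositional.Properties
  using (++⁺; ++⁺ˡ; ++⁺ʳ; ++-comm; shift; shifts; map⁺; filter-↭; drop-∷; ∷↭∷ʳ; ↭-length;
         All-resp-↭; ∈-resp-↭)
import Data.List.Relation.Binary.Permutation.Setoid.Properties as Permutationₛ
open import Data.List.Relation.Unary.All as All using (All; []; _∷_; all?)
import Data.List.Relation.Unary.All.Properties as All
open import Data.List.Relation.Unary.AllPairs as AllPairs using (AllPairs; []; _∷_)
import Data.List.Relation.Unary.AllPairs.Properties as AllPairs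
open import Data.List.Relation.Unary.Any using (here; there)
open import Data.List.Relation.Unary.Linked using (linked?)
open import Data.List.Relation.Unary.Linked.Properties using (Linked⇒AllPairs)
open import Data.List.Relation.Unary.Sorted.TotalOrder.Properties using (↗↭↗⇒≋)
open import Data.List.Relation.Unary.Unique.Propositional using (Unique)
import Data.List.Relation.Unary.Unique.Propositional.Properties as Unique
open import Data.List.Sort.Base using (module SortingAlgorithm)
import Data.List.Sort.InsertionSort as InsertionSort
open import Data.Maybe.Base using (Maybe; just; nothing; maybe′)
open import Data.Nat.Base as ℕ using (ℕ; zero; suc; pred; _≤_; _<_; _≥_; z≤n; s≤s; NonZero)
open import Data.Nat.GeneralisedArithmetic using (fold)
open import Data.Nat.ListAction using (sum)
open import Data.Nat.ListAction.Properties using (sum-↭)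
import Data.Nat.Properties as ℕ
open import Data.Product.Base using (_×_; _,_; ∃; ∃₂; proj₂)
open import Data.Sum.Base using (_⊎_; inj₁; inj₂; [_,_]′)
open import Function.Base using (_∘_; id)
open import Relation.Binary.Bundles using (DecTotalOrder)
open import Relation.Binary.PropositionalEquality hiding ([_])
open import Relation.Nullary.Decidable
  using (Dec; yes; no; does; dec-true; dec-false; recompute; _×-dec_)
open import Relation.Nullary.Negation using (¬_; contradiction)
open import Relation.Unary using (Decidable)
open import Defs

-- The hypothesis on `a` speaks only of coefficients at actual permutations. So for the given `ρ`
-- and `m` a concrete `σ` is constructed with the last point in a cycle of length `m`, and each
-- value of `a` on the right is read off as the coefficient at some `σ · transpose j n`. The factor
-- `part ρ i` counts the points `j` of one block, all of which yield the same cycle type. In the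
-- cycle of the last point each `j` cuts at a different place, so every ordered pair of lengths
-- arises exactly once. The obstacle is that `cycleType` is defined by a search through orbits and
-- cannot be followed through a product. Explicit lists of cycles serve as certificates instead:
-- they are cut and glued as lists, and a single comparison shows that they determine `cycleType`.

private variable
  A B C : Set
  n : ℕ

-- Finite integer sums over lists, and indicators of decidable propositions

∑ₗ : List A → (A → ℤ) → ℤ
∑ₗ []       f = 0ℤ
∑ₗ (x ∷ xs) f = f x + ∑ₗ xs f

∑ₗ-cong-∈ : ∀ (xs : List A) {f g} → (∀ {x} → x ∈ xs → f x ≡ g x) → ∑ₗ xs f ≡ ∑ₗ xs g
∑ₗ-cong-∈ []       f≗g = refl
∑ₗ-cong-∈ (x ∷ xs) f≗g = cong₂ _+_ (f≗g (here refl)) (∑ₗ-cong-∈ xs (f≗g ∘ there))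

∑ₗ-cong : ∀ (xs : List A) {f g} → (∀ x → f x ≡ g x) → ∑ₗ xs f ≡ ∑ₗ xs g
∑ₗ-cong xs f≗g = ∑ₗ-cong-∈ xs (λ {x} _ → f≗g x)

∑ₗ-++ : ∀ (xs ys : List A) {f} → ∑ₗ (xs ++ ys) f ≡ ∑ₗ xs f + ∑ₗ ys f
∑ₗ-++ []       ys {f} = sym (+-identityˡ (∑ₗ ys f))
∑ₗ-++ (x ∷ xs) ys {f} = trans (cong (_+_ (f x)) (∑ₗ-++ xs ys)) (sym (+-assoc (f x) _ _))

∑ₗ-map : ∀ (g : A → B) xs {f} → ∑ₗ (map g xs) f ≡ ∑ₗ xs (f ∘ g)
∑ₗ-map g []       = refl
∑ₗ-map g (x ∷ xs) {f} = cong (_+_ (f (g x))) (∑ₗ-map g xs)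

∑ₗ-concatMap : ∀ (g : A → List B) xs {f} → ∑ₗ (concatMap g xs) f ≡ ∑ₗ xs (λ x → ∑ₗ (g x) f)
∑ₗ-concatMap g []       = refl
∑ₗ-concatMap g (x ∷ xs) {f} = trans (∑ₗ-++ (g x) _) (cong (_+_ (∑ₗ (g x) f)) (∑ₗ-concatMap g xs))

∑ₗ-cartesianProductWith : ∀ (g : A → B → C) xs ys {f} →
  ∑ₗ (cartesianProductWith g xs ys) f ≡ ∑ₗ xs (λ x → ∑ₗ ys (λ y → f (g x y)))
∑ₗ-cartesianProductWith g []       ys = refl
∑ₗ-cartesianProductWith g (x ∷ xs) ys =
  trans (∑ₗ-++ (map (g x) ys) _)
        (cong₂ _+_ (∑ₗ-map (g x) ys) (∑ₗ-cartesianProductWith g xs ys))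

∑ₗ-↭ : ∀ {xs ys : List A} {f} → xs ↭ ys → ∑ₗ xs f ≡ ∑ₗ ys f
∑ₗ-↭ ↭.refl           = refl
∑ₗ-↭ {f = f} (↭.prep x p) = cong (_+_ (f x)) (∑ₗ-↭ p)
∑ₗ-↭ {f = f} (↭.swap {xs} {ys} x y p) = begin
  f x + (f y + ∑ₗ xs f) ≡⟨ cong (λ s → f x + (f y + s)) (∑ₗ-↭ p) ⟩
  f x + (f y + ∑ₗ ys f) ≡⟨ +-assoc (f x) (f y) _ ⟨
  f x + f y + ∑ₗ ys f   ≡⟨ cong (_+ ∑ₗ ys f) (+-comm (f x) (f y)) ⟩
  f y + f x + ∑ₗ ys f   ≡⟨ +-assoc (f y) (f x) _ ⟩
  f y + (f x + ∑ₗ ys f) ∎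
  where open ≡-Reasoning
∑ₗ-↭ (↭.trans p q)    = trans (∑ₗ-↭ p) (∑ₗ-↭ q)

∑ₗ-zero : ∀ (xs : List A) → ∑ₗ xs (λ _ → 0ℤ) ≡ 0ℤ
∑ₗ-zero []       = refl
∑ₗ-zero (x ∷ xs) = trans (+-identityˡ _) (∑ₗ-zero xs)

∑ₗ-+ : ∀ (xs : List A) {f g} → ∑ₗ xs (λ x → f x + g x) ≡ ∑ₗ xs f + ∑ₗ xs g
∑ₗ-+ []       = refl
∑ₗ-+ (x ∷ xs) {f} {g} =
  trans (cong (_+_ (f x + g x)) (∑ₗ-+ xs)) (CommutativeSemigroup.interchange +-commutativeSemigroup (f x) (g x) _ _)

*-distribˡ-∑ₗ : ∀ (xs : List A) c {f} → c * ∑ₗ xs f ≡ ∑ₗ xs (λ x → c * f x)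
*-distribˡ-∑ₗ []       c = *-zeroʳ c
*-distribˡ-∑ₗ (x ∷ xs) c {f} =
  trans (*-distribˡ-+ c (f x) _) (cong (_+_ (c * f x)) (*-distribˡ-∑ₗ xs c))

∑ₗ-comm : ∀ (xs : List A) (ys : List B) {f : A → B → ℤ} →
  ∑ₗ xs (λ x → ∑ₗ ys (f x)) ≡ ∑ₗ ys (λ y → ∑ₗ xs (λ x → f x y))
∑ₗ-comm []       ys = sym (∑ₗ-zero ys)
∑ₗ-comm (x ∷ xs) ys {f} = trans (cong (_+_ (∑ₗ ys (f x))) (∑ₗ-comm xs ys)) (sym (∑ₗ-+ ys))

∑ₗ-only : ∀ {xs : List A} {x f} → Unique xs → x ∈ xs →
  (∀ {y} → y ≢ x → f y ≡ 0ℤ) → ∑ₗ xs f ≡ f x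
∑ₗ-only {xs = x ∷ xs} {f = f} (x∉xs ∷ _) (here refl) f≢ = trans
  (cong (_+_ (f x)) (trans (∑ₗ-cong-∈ xs (λ y∈xs → f≢ (All.lookup x∉xs y∈xs ∘ sym))) (∑ₗ-zero xs)))
  (+-identityʳ _)
∑ₗ-only (y∉xs ∷ xs!) (there x∈xs) f≢ = trans
  (cong₂ _+_ (f≢ (All.lookup y∉xs x∈xs)) (∑ₗ-only xs! x∈xs f≢))
  (+-identityˡ _)

∑ₗ-constant : ∀ (xs : List A) {f c} → (∀ {x} → x ∈ xs → f x ≡ c) → ∑ₗ xs f ≡ + length xs * c
∑ₗ-constant []       {c = c} f≡c = sym (*-zeroˡ c)
∑ₗ-constant (x ∷ xs) {c = c} f≡c = trans
  (cong₂ _+_ (f≡c (here refl)) (∑ₗ-constant xs (f≡c ∘ there)))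
  (sym (suc-* (+ length xs) c))

𝟙 : ∀ {P : Set} → Dec P → ℤ
𝟙 P? = if does P? then 1ℤ else 0ℤ

𝟙-true : ∀ {P : Set} (P? : Dec P) → P → 𝟙 P? ≡ 1ℤ
𝟙-true P? p = cong (if_then 1ℤ else 0ℤ) (dec-true P? p)

𝟙-false : ∀ {P : Set} (P? : Dec P) → ¬ P → 𝟙 P? ≡ 0ℤ
𝟙-false P? ¬p = cong (if_then 1ℤ else 0ℤ) (dec-false P? ¬p)

𝟙-cong : ∀ {P Q : Set} → (P → Q) → (Q → P) → (P? : Dec P) (Q? : Dec Q) → 𝟙 P? ≡ 𝟙 Q?
𝟙-cong P⇒Q Q⇒P (yes p) Q? = sym (𝟙-true Q? (P⇒Q p))
𝟙-cong P⇒Q Q⇒P (no ¬p) Q? = sym (𝟙-false Q? (¬p ∘ Q⇒P))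

∑ₗ-filter : ∀ {P : A → Set} (P? : Decidable P) xs {f} →
  ∑ₗ (filter P? xs) f ≡ ∑ₗ xs (λ x → 𝟙 (P? x) * f x)
∑ₗ-filter P? []       = refl
∑ₗ-filter P? (x ∷ xs) {f} with does (P? x)
... | true  = cong₂ _+_ (sym (*-identityˡ (f x))) (∑ₗ-filter P? xs)
... | false = trans (∑ₗ-filter P? xs) (sym (+-identityˡ _))

-- Linear functionals on ℤ[Sₙ]

-- Formal combinations may repeat a permutation, so they are studied through linear extensions of
-- functions `f` on permutations. The coefficient at `σ` is the pairing with the indicator
-- `[_≈ σ ]`, and a product becomes an iterated pairing.
⟨_∣_⟩ : ℤ[S n ] → (Permutation′ n → ℤ) → ℤ
⟨ x ∣ f ⟩ = ∑ₗ x (λ (c , τ) → c * f τ)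

-- Laws such as associativity of `_·_` are used here only up to pointwise equality `Perm._≈_`, so
-- only functions respecting it may be rewritten along them.
Extensional : (Permutation′ n → ℤ) → Set
Extensional f = ∀ {σ τ} → σ Perm.≈ τ → f σ ≡ f τ

[_≈_] : Permutation′ n → Permutation′ n → ℤ
[ τ ≈ σ ] = 𝟙 (τ ≈? σ)

[≈]-extensional : ∀ (σ : Permutation′ n) → Extensional [_≈ σ ]
[≈]-extensional σ {τ} {υ} τ≈υ = 𝟙-cong
  (λ τ≈σ i → trans (sym (τ≈υ i)) (τ≈σ i)) (λ υ≈σ i → trans (τ≈υ i) (υ≈σ i))
  (τ ≈? σ) (υ ≈? σ)

coeff≡⟨∣⟩ : ∀ (σ : Permutation′ n) x → coeff σ x ≡ ⟨ x ∣ [_≈ σ ] ⟩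
coeff≡⟨∣⟩ σ []            = refl
coeff≡⟨∣⟩ σ ((c , τ) ∷ x) = cong₂ _+_ (scale (does (τ ≈? σ))) (coeff≡⟨∣⟩ σ x)
  where
  scale : ∀ b → (if b then c else 0ℤ) ≡ c * (if b then 1ℤ else 0ℤ)
  scale true  = sym (*-identityʳ c)
  scale false = sym (*-zeroʳ c)

⟨∣⟩-cong : ∀ (x : ℤ[S n ]) {f g} → (∀ τ → f τ ≡ g τ) → ⟨ x ∣ f ⟩ ≡ ⟨ x ∣ g ⟩
⟨∣⟩-cong x f≗g = ∑ₗ-cong x (λ (c , τ) → cong (c *_) (f≗g τ))

⟨sumOf∣⟩ : ∀ (τs : List (Permutation′ n)) {f} → ⟨ sumOf τs ∣ f ⟩ ≡ ∑ₗ τs f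
⟨sumOf∣⟩ τs = trans (∑ₗ-map _ τs) (∑ₗ-cong τs (λ _ → *-identityˡ _))

⟨•∣⟩ : ∀ c (x : ℤ[S n ]) {f} → ⟨ c • x ∣ f ⟩ ≡ c * ⟨ x ∣ f ⟩
⟨•∣⟩ c x = trans (∑ₗ-map _ x)
  (trans (∑ₗ-cong x (λ (d , _) → *-assoc c d _)) (sym (*-distribˡ-∑ₗ x c)))

⟨⊛∣⟩ : ∀ (x y : ℤ[S n ]) {f} → ⟨ x ⊛ y ∣ f ⟩ ≡ ⟨ x ∣ (λ τ → ⟨ y ∣ (λ υ → f (τ · υ)) ⟩) ⟩
⟨⊛∣⟩ x y {f} = trans (∑ₗ-cartesianProductWith _ x y)
  (∑ₗ-cong x (λ (c , τ) → trans (∑ₗ-cong y (λ (d , υ) → *-assoc c d _)) (sym (*-distribˡ-∑ₗ y c))))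

⟨∣⟩-∑ₗ : ∀ (x : ℤ[S n ]) (ys : List A) {f : A → Permutation′ n → ℤ} →
  ⟨ x ∣ (λ τ → ∑ₗ ys (λ y → f y τ)) ⟩ ≡ ∑ₗ ys (λ y → ⟨ x ∣ f y ⟩)
⟨∣⟩-∑ₗ x ys = trans (∑ₗ-cong x (λ (c , τ) → *-distribˡ-∑ₗ ys c)) (∑ₗ-comm x ys)

-- The last-letter recursion for complete homogeneous symmetric functions

-- A weakly increasing word either avoids the final letter or ends with it. Since `monomials`
-- branches on the first letter, the induction yields four groups, of which the middle two have to
-- be exchanged; hence a permutation and not an equality.
monomials-∷ʳ : ∀ k (xs : List A) y →
  monomials (suc k) (xs ∷ʳ y) ↭ monomials (suc k) xs ++ map (_∷ʳ y) (monomials k (xs ∷ʳ y))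
monomials-∷ʳ zero    []       y = ↭-refl
monomials-∷ʳ (suc k) []       y = begin
  map (y ∷_) (monomials (suc k) (y ∷ [])) ++ []  ≡⟨ ++-identityʳ _ ⟩
  map (y ∷_) (monomials (suc k) (y ∷ []))        ↭⟨ map⁺ _ (monomials-∷ʳ k [] y) ⟩
  map (y ∷_) (map (_∷ʳ y) (monomials k (y ∷ []))) ≡⟨ map-∘ _ ⟨
  map (λ w → y ∷ (w ∷ʳ y)) (monomials k (y ∷ [])) ≡⟨ map-∘ _ ⟩
  map (_∷ʳ y) (map (y ∷_) (monomials k (y ∷ []))) ≡⟨ cong (map (_∷ʳ y)) (++-identityʳ _) ⟨
  map (_∷ʳ y) (map (y ∷_) (monomials k (y ∷ [])) ++ []) ∎
  where open PermutationReasoning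
monomials-∷ʳ zero    (x ∷ xs) y = ↭.prep _ (monomials-∷ʳ zero xs y)
monomials-∷ʳ (suc k) (x ∷ xs) y = begin
  map (x ∷_) (monomials (suc k) (x ∷ xs ∷ʳ y)) ++ monomials (2 ℕ.+ k) (xs ∷ʳ y)
    ↭⟨ ++⁺ (map⁺ (x ∷_) (monomials-∷ʳ k (x ∷ xs) y)) (monomials-∷ʳ (suc k) xs y) ⟩
  map (x ∷_) (M₁ ++ map (_∷ʳ y) M₂) ++ M₃ ++ map (_∷ʳ y) M₄
    ≡⟨ cong (_++ M₃ ++ map (_∷ʳ y) M₄) (map-++ (x ∷_) M₁ _) ⟩
  (map (x ∷_) M₁ ++ map (x ∷_) (map (_∷ʳ y) M₂)) ++ M₃ ++ map (_∷ʳ y) M₄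
    ≡⟨ ++-assoc (map (x ∷_) M₁) _ _ ⟩
  map (x ∷_) M₁ ++ map (x ∷_) (map (_∷ʳ y) M₂) ++ M₃ ++ map (_∷ʳ y) M₄
    ↭⟨ ++⁺ˡ (map (x ∷_) M₁) (shifts (map (x ∷_) (map (_∷ʳ y) M₂)) M₃) ⟩
  map (x ∷_) M₁ ++ M₃ ++ map (x ∷_) (map (_∷ʳ y) M₂) ++ map (_∷ʳ y) M₄
    ≡⟨ ++-assoc (map (x ∷_) M₁) _ _ ⟨
  (map (x ∷_) M₁ ++ M₃) ++ map (x ∷_) (map (_∷ʳ y) M₂) ++ map (_∷ʳ y) M₄
    ≡⟨ cong (λ M → (map (x ∷_) M₁ ++ M₃) ++ M ++ map (_∷ʳ y) M₄) (trans (sym (map-∘ M₂)) (map-∘ M₂)) ⟩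
  (map (x ∷_) M₁ ++ M₃) ++ map (_∷ʳ y) (map (x ∷_) M₂) ++ map (_∷ʳ y) M₄
    ≡⟨ cong ((map (x ∷_) M₁ ++ M₃) ++_) (map-++ (_∷ʳ y) (map (x ∷_) M₂) M₄) ⟨
  (map (x ∷_) M₁ ++ M₃) ++ map (_∷ʳ y) (map (x ∷_) M₂ ++ M₄) ∎
  where
  open PermutationReasoning
  M₁ = monomials (suc k) (x ∷ xs)
  M₂ = monomials k (x ∷ xs ∷ʳ y)
  M₃ = monomials (2 ℕ.+ k) xs
  M₄ = monomials (suc k) (xs ∷ʳ y)

monomials-map : ∀ k (g : A → B) xs → monomials k (map g xs) ≡ map (map g) (monomials k xs)
monomials-map zero    g xs       = refl
monomials-map (suc k) g []       = refl
monomials-map (suc k) g (x ∷ xs) = begin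
  map (g x ∷_) (monomials k (map g (x ∷ xs))) ++ monomials (suc k) (map g xs)
    ≡⟨ cong₂ (λ M N → map (g x ∷_) M ++ N) (monomials-map k g (x ∷ xs)) (monomials-map (suc k) g xs) ⟩
  map (g x ∷_) (map (map g) (monomials k (x ∷ xs))) ++ map (map g) (monomials (suc k) xs)
    ≡⟨ cong (_++ map (map g) (monomials (suc k) xs)) (trans (sym (map-∘ M)) (map-∘ M)) ⟩
  map (map g) (map (x ∷_) (monomials k (x ∷ xs))) ++ map (map g) (monomials (suc k) xs)
    ≡⟨ map-++ (map g) (map (x ∷_) (monomials k (x ∷ xs))) _ ⟨
  map (map g) (monomials (suc k) (x ∷ xs)) ∎
  where
  open ≡-Reasoning
  M = monomials k (x ∷ xs)

word : List ℤ[S n ] → ℤ[S n ]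
word = foldr _⊛_ one

-- `word` nests to the right and closes with `one`, so the new last factor sits deepest inside;
-- reassociating and moving it past `one` makes it a right factor of the whole product.
⟨word∷ʳ∣⟩ : ∀ (w : List ℤ[S n ]) y {f} → Extensional f →
  ⟨ word (w ∷ʳ y) ∣ f ⟩ ≡ ⟨ word w ∣ (λ τ → ⟨ y ∣ (λ υ → f (τ · υ)) ⟩) ⟩
⟨word∷ʳ∣⟩ [] y {f} f-ext = begin
  ⟨ y ⊛ one ∣ f ⟩                                        ≡⟨ ⟨⊛∣⟩ y one ⟩
  ⟨ y ∣ (λ υ → ⟨ one ∣ (λ τ → f (υ · τ)) ⟩) ⟩            ≡⟨ ⟨∣⟩-cong y (λ υ → ⟨sumOf∣⟩ [ Perm.id ] {λ τ → f (υ · τ)}) ⟩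
  ⟨ y ∣ (λ υ → f (υ · Perm.id) + 0ℤ) ⟩                   ≡⟨ ⟨∣⟩-cong y (λ υ → trans (+-identityʳ _) (f-ext (λ _ → refl))) ⟩
  ⟨ y ∣ (λ υ → f (Perm.id · υ)) ⟩                        ≡⟨ +-identityʳ _ ⟨
  ⟨ y ∣ (λ υ → f (Perm.id · υ)) ⟩ + 0ℤ                   ≡⟨ ⟨sumOf∣⟩ [ Perm.id ] {λ τ → ⟨ y ∣ (λ υ → f (τ · υ)) ⟩} ⟨
  ⟨ one ∣ (λ τ → ⟨ y ∣ (λ υ → f (τ · υ)) ⟩) ⟩            ∎
  where open ≡-Reasoning
⟨word∷ʳ∣⟩ (x ∷ w) y {f} f-ext = begin
  ⟨ x ⊛ word (w ∷ʳ y) ∣ f ⟩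
    ≡⟨ ⟨⊛∣⟩ x (word (w ∷ʳ y)) ⟩
  ⟨ x ∣ (λ τ → ⟨ word (w ∷ʳ y) ∣ (λ υ → f (τ · υ)) ⟩) ⟩
    ≡⟨ ⟨∣⟩-cong x (λ τ → ⟨word∷ʳ∣⟩ w y (λ υ≈φ → f-ext (λ i → cong (τ ⟨$⟩ʳ_) (υ≈φ i)))) ⟩
  ⟨ x ∣ (λ τ → ⟨ word w ∣ (λ υ → ⟨ y ∣ (λ φ → f (τ · (υ · φ))) ⟩) ⟩) ⟩
    ≡⟨ ⟨∣⟩-cong x (λ τ → ⟨∣⟩-cong (word w) (λ υ → ⟨∣⟩-cong y (λ φ → f-ext (λ _ → refl)))) ⟩
  ⟨ x ∣ (λ τ → ⟨ word w ∣ (λ υ → ⟨ y ∣ (λ φ → f (τ · υ · φ)) ⟩) ⟩) ⟩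
    ≡⟨ ⟨⊛∣⟩ x (word w) ⟨
  ⟨ x ⊛ word w ∣ (λ τ → ⟨ y ∣ (λ υ → f (τ · υ)) ⟩) ⟩ ∎
  where open ≡-Reasoning

⟨h∣⟩ : ∀ k (xs : List ℤ[S n ]) {f} → ⟨ h k xs ∣ f ⟩ ≡ ∑ₗ (monomials k xs) (λ w → ⟨ word w ∣ f ⟩)
⟨h∣⟩ k xs = ∑ₗ-concatMap word (monomials k xs)

⟨h-∷ʳ∣⟩ : ∀ k (xs : List ℤ[S n ]) y {f} → Extensional f →
  ⟨ h (suc k) (xs ∷ʳ y) ∣ f ⟩ ≡
  ⟨ h (suc k) xs ∣ f ⟩ + ⟨ h k (xs ∷ʳ y) ∣ (λ τ → ⟨ y ∣ (λ υ → f (τ · υ)) ⟩) ⟩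
⟨h-∷ʳ∣⟩ k xs y {f} f-ext = begin
  ⟨ h (suc k) (xs ∷ʳ y) ∣ f ⟩
    ≡⟨ ⟨h∣⟩ (suc k) (xs ∷ʳ y) ⟩
  ∑ₗ (monomials (suc k) (xs ∷ʳ y)) (λ w → ⟨ word w ∣ f ⟩)
    ≡⟨ ∑ₗ-↭ (monomials-∷ʳ k xs y) ⟩
  ∑ₗ (monomials (suc k) xs ++ map (_∷ʳ y) M) (λ w → ⟨ word w ∣ f ⟩)
    ≡⟨ ∑ₗ-++ (monomials (suc k) xs) _ ⟩
  ∑ₗ (monomials (suc k) xs) (λ w → ⟨ word w ∣ f ⟩) + ∑ₗ (map (_∷ʳ y) M) (λ w → ⟨ word w ∣ f ⟩)
    ≡⟨ cong₂ _+_ (sym (⟨h∣⟩ (suc k) xs)) (∑ₗ-map (_∷ʳ y) M) ⟩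
  ⟨ h (suc k) xs ∣ f ⟩ + ∑ₗ M (λ w → ⟨ word (w ∷ʳ y) ∣ f ⟩)
    ≡⟨ cong (_+_ ⟨ h (suc k) xs ∣ f ⟩) (∑ₗ-cong M (λ w → ⟨word∷ʳ∣⟩ w y f-ext)) ⟩
  ⟨ h (suc k) xs ∣ f ⟩ + ∑ₗ M (λ w → ⟨ word w ∣ (λ τ → ⟨ y ∣ (λ υ → f (τ · υ)) ⟩) ⟩)
    ≡⟨ cong (_+_ ⟨ h (suc k) xs ∣ f ⟩) (⟨h∣⟩ k (xs ∷ʳ y)) ⟨
  ⟨ h (suc k) xs ∣ f ⟩ + ⟨ h k (xs ∷ʳ y) ∣ (λ τ → ⟨ y ∣ (λ υ → f (τ · υ)) ⟩) ⟩ ∎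
  where
  open ≡-Reasoning
  M = monomials k (xs ∷ʳ y)

-- Permutations and uniqueness of lists

Unique-resp-↭ : ∀ {xs ys : List A} → xs ↭ ys → Unique xs → Unique ys
Unique-resp-↭ xs↭ys = Permutationₛ.Unique-resp-↭ (setoid _) (↭⇒↭ₛ xs↭ys)

Unique-++⁻ˡ : ∀ (xs : List A) {ys} → Unique (xs ++ ys) → Unique xs
Unique-++⁻ˡ []       _          = []
Unique-++⁻ˡ (x ∷ xs) (x∉ ∷ xs!) = All.++⁻ˡ xs x∉ ∷ Unique-++⁻ˡ xs xs!

Unique⇒disjoint : ∀ (xs : List A) {ys v} → Unique (xs ++ ys) → v ∈ xs → v ∉ ys
Unique⇒disjoint (x ∷ xs) (x∉ ∷ _)  (here refl)  v∈ys = All.lookup (All.++⁻ʳ xs x∉) v∈ys refl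
Unique⇒disjoint (x ∷ xs) (_ ∷ xs!) (there v∈xs) v∈ys = Unique⇒disjoint xs xs! v∈xs v∈ys

filter-unique : ∀ {P : A → Set} (P? : Decidable P) {xs x} → Unique xs → x ∈ xs → P x →
  (∀ {y} → y ∈ xs → P y → y ≡ x) → filter P? xs ≡ [ x ]
filter-unique P? {_ ∷ xs} (x∉ ∷ _) (here refl) px P⇒≡ = trans (filter-accept P? px)
  (cong (_ ∷_) (filter-none P? (All.tabulate (λ y∈xs py →
    All.lookup x∉ y∈xs (sym (P⇒≡ (there y∈xs) py))))))
filter-unique P? (x∉ ∷ xs!) (there x∈xs) px P⇒≡ = trans
  (filter-reject P? (λ py → All.lookup x∉ x∈xs (P⇒≡ (here refl) py)))
  (filter-unique P? xs! x∈xs px (P⇒≡ ∘ there))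

concat-↭ : ∀ {xss yss : List (List A)} → xss ↭ yss → concat xss ↭ concat yss
concat-↭ ↭.refl            = ↭-refl
concat-↭ (↭.prep xs p)     = ++⁺ˡ xs (concat-↭ p)
concat-↭ (↭.swap xs ys p)  = ↭-trans (++⁺ˡ xs (++⁺ˡ ys (concat-↭ p))) (shifts xs ys)
concat-↭ (↭.trans p q)     = ↭-trans (concat-↭ p) (concat-↭ q)

∈⇒↭∷ : ∀ {x : A} {xs} → x ∈ xs → ∃ λ ys → xs ↭ x ∷ ys
∈⇒↭∷ {x = x} x∈xs with ys , zs , refl ← ∈-∃++ x∈xs = ys ++ zs , shift x ys zs

-- Cycles of a function

-- The list holds only the points strictly between the two ends. A closed path thus lists each step
-- of a cycle once, and cutting or gluing cycles is splitting or concatenating lists.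
Path : (A → A) → A → List A → A → Set
Path f x []       y = f x ≡ y
Path f x (z ∷ zs) y = f x ≡ z × Path f z zs y

IsCycle : (A → A) → List A → Set
IsCycle f []       = ⊥
IsCycle f (x ∷ xs) = Path f x xs x

module _ {f : A → A} where

  Path-++⁺ : ∀ {x y z} xs {ys} → Path f x xs y → Path f y ys z → Path f x (xs ++ y ∷ ys) z
  Path-++⁺ []       fx≡y       q = fx≡y , q
  Path-++⁺ (_ ∷ xs) (fx≡ , p) q = fx≡ , Path-++⁺ xs p q

  Path-++⁻ : ∀ {x y z} xs {ys} → Path f x (xs ++ y ∷ ys) z → Path f x xs y × Path f y ys z
  Path-++⁻ []       p         = p
  Path-++⁻ (_ ∷ xs) (fx≡ , p) with p₁ , p₂ ← Path-++⁻ xs p = (fx≡ , p₁) , p₂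

  IsCycle-rotate : ∀ xs {y ys} → IsCycle f (xs ++ y ∷ ys) → IsCycle f (y ∷ ys ++ xs)
  IsCycle-rotate []       {ys = ys} p = subst (λ zs → Path f _ zs _) (sym (++-identityʳ ys)) p
  IsCycle-rotate (x ∷ xs) {ys = ys} p with p₁ , p₂ ← Path-++⁻ xs p = Path-++⁺ ys p₂ p₁

  -- The starting point may change together with the function: multiplying by a transposition lets
  -- one point take over the image of another, and hence the path that follows it.
  Path-cong : ∀ {g : A → A} {x x′ y} zs → f x ≡ g x′ → All (λ z → f z ≡ g z) zs →
              Path f x zs y → Path g x′ zs y
  Path-cong []       fx≡gx′ []          fx≡y      = trans (sym fx≡gx′) fx≡y
  Path-cong (z ∷ zs) fx≡gx′ (eq ∷ eqs) (fx≡z , p) = trans (sym fx≡gx′) fx≡z , Path-cong zs eq eqs p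

  IsCycle-cong : ∀ {g : A → A} {zs} → All (λ z → f z ≡ g z) zs → IsCycle f zs → IsCycle g zs
  IsCycle-cong {zs = z ∷ zs} (eq ∷ eqs) = Path-cong zs eq eqs

  Path-map : ∀ {g : B → B} (ι : A → B) → (∀ z → g (ι z) ≡ ι (f z)) → ∀ {x y} zs →
             Path f x zs y → Path g (ι x) (map ι zs) (ι y)
  Path-map ι gι≡ιf []       fx≡y       = trans (gι≡ιf _) (cong ι fx≡y)
  Path-map ι gι≡ιf (z ∷ zs) (fx≡z , p) = trans (gι≡ιf _) (cong ι fx≡z) , Path-map ι gι≡ιf zs p

  IsCycle-map : ∀ {g : B → B} (ι : A → B) → (∀ z → g (ι z) ≡ ι (f z)) → ∀ {zs} →
                IsCycle f zs → IsCycle g (map ι zs)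
  IsCycle-map ι gι≡ιf {z ∷ zs} = Path-map ι gι≡ιf zs

  Path-closed : ∀ {x y z} zs → Path f x zs y → z ∈ x ∷ zs → f z ≡ y ⊎ f z ∈ zs
  Path-closed []       fx≡y          (here refl) = inj₁ fx≡y
  Path-closed (_ ∷ _)  (fx≡z , _)    (here refl) = inj₂ (here fx≡z)
  Path-closed (_ ∷ zs) (_ , p)       (there z∈)  with Path-closed zs p z∈
  ... | inj₁ eq = inj₁ eq
  ... | inj₂ ∈zs = inj₂ (there ∈zs)

  IsCycle-closed : ∀ {z c} → IsCycle f c → z ∈ c → f z ∈ c
  IsCycle-closed {c = _ ∷ zs} p z∈c = [ here , there ]′ (Path-closed zs p z∈c)

  -- `w` and `k` strengthen the induction: `k` steps from `w` have already led to `x`, and the rest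
  -- of the path adds at most its length.
  Path-reaches : ∀ {x y z} zs → Path f x zs y → z ∈ x ∷ zs →
                 ∀ w k → fold w f k ≡ x → ∃ λ l → l ≤ k ℕ.+ length zs × fold w f l ≡ z
  Path-reaches zs       _          (here refl) w k wk≡x = k , ℕ.m≤m+n k _ , wk≡x
  Path-reaches (_ ∷ zs) (fx≡ , p) (there z∈)  w k wk≡x
    with l , l≤ , wl≡z ← Path-reaches zs p z∈ w (suc k) (trans (cong f wk≡x) fx≡)
    = l , ℕ.≤-trans l≤ (ℕ.≤-reflexive (sym (ℕ.+-suc k (length zs)))) , wl≡z

  IsCycle-reaches : ∀ {c x y} → IsCycle f c → x ∈ c → y ∈ c →
                    ∃ λ l → l ℕ.< length c × fold x f l ≡ y
  IsCycle-reaches p x∈c y∈c with xs , ys , refl ← ∈-∃++ x∈c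
    with l , l≤ , eq ← Path-reaches (ys ++ xs) (IsCycle-rotate xs p)
                         (∈-resp-↭ (++-comm xs (_ ∷ ys)) y∈c) _ 0 refl
    = l , ℕ.≤-trans (s≤s l≤) (ℕ.≤-reflexive (↭-length (++-comm (_ ∷ ys) xs))) , eq

-- Cycle decompositions of permutations

-- `IsCycle` alone allows repeated points; `complete` excludes them and makes the blocks disjoint,
-- because `allFin n` is free of repetitions. The order of the blocks and the starting point of each
-- stay free.
record Decomposition (σ : Permutation′ n) (css : List (List (Fin n))) : Set where
  constructor decomposition
  field
    cycles   : All (IsCycle (σ ⟨$⟩ʳ_)) css
    complete : concat css ↭ allFin n

  unique : Unique (concat css)
  unique = Unique-resp-↭ (↭-sym complete) (Unique.allFin⁺ n)

open Decomposition using (cycles; complete; unique)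

Decomposition-resp-↭ : ∀ {σ : Permutation′ n} {css dss} → css ↭ dss →
  Decomposition σ css → Decomposition σ dss
Decomposition-resp-↭ p (decomposition cyc com) =
  decomposition (All-resp-↭ p cyc) (↭-trans (concat-↭ (↭-sym p)) com)

Decomposition-resp-≈ : ∀ {σ τ : Permutation′ n} {css} → σ Perm.≈ τ →
  Decomposition σ css → Decomposition τ css
Decomposition-resp-≈ σ≈τ (decomposition cyc com) =
  decomposition (All.map (λ {c} → IsCycle-cong (All.universal σ≈τ c)) cyc) com

Decomposition-rotate : ∀ {σ : Permutation′ n} xs {y ys css} →
  Decomposition σ ((xs ++ y ∷ ys) ∷ css) → Decomposition σ ((y ∷ ys ++ xs) ∷ css)
Decomposition-rotate xs {y} {ys} (decomposition (c ∷ cs) com) =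
  decomposition (IsCycle-rotate xs c ∷ cs) (↭-trans (++⁺ʳ _ (++-comm (y ∷ ys) xs)) com)

module _ {σ : Permutation′ n} where

  SameCycle⇒∈ : ∀ {c x y} → IsCycle (σ ⟨$⟩ʳ_) c → x ∈ c → SameCycle σ x y → y ∈ c
  SameCycle⇒∈ {c} {x} p x∈c (k , refl) = go (toℕ k)
    where
    go : ∀ l → fold x (σ ⟨$⟩ʳ_) l ∈ c
    go zero    = x∈c
    go (suc l) = IsCycle-closed p (go l)

  module _ {c css} (d : Decomposition σ (c ∷ css)) where

    length-cycle≤ : length c ≤ n
    length-cycle≤ = begin
      length c                          ≤⟨ ℕ.m≤m+n _ _ ⟩
      length c ℕ.+ length (concat css)  ≡⟨ length-++ c ⟨
      length (c ++ concat css)          ≡⟨ ↭-length (complete d) ⟩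
      length (allFin n)                 ≡⟨ length-tabulate id ⟩
      n                                 ∎
      where open ℕ.≤-Reasoning

    ∈⇒SameCycle : ∀ {x y} → x ∈ c → y ∈ c → SameCycle σ x y
    ∈⇒SameCycle {x} x∈c y∈c with l , l< , eq ← IsCycle-reaches (All.head (cycles d)) x∈c y∈c =
      -- `SameCycle` admits only exponents below `n`, so the step count, which is below the length
      -- of the block, has to be compared with `n`.
      fromℕ< l<n , trans (cong (fold x _) (Fin.toℕ-fromℕ< l<n)) eq
      where l<n = ℕ.≤-trans l< length-cycle≤

    -- Filtering `c ++ concat css` in place of `allFin n` keeps all of `c`, as every point of it is
    -- reached, and nothing else, as `c` is closed under `σ` and disjoint from the other blocks.
    length-cycle : ∀ {x} → x ∈ c → length (cycle σ x) ≡ length c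
    length-cycle {x} x∈c = begin
      length (filter same? (allFin n))
        ≡⟨ ↭-length (filter-↭ same? (complete d)) ⟨
      length (filter same? (c ++ concat css))
        ≡⟨ cong length (filter-++ same? c (concat css)) ⟩
      length (filter same? c ++ filter same? (concat css))
        ≡⟨ cong₂ (λ xs ys → length (xs ++ ys))
             (filter-all same? (All.tabulate (∈⇒SameCycle x∈c)))
             (filter-none same? (All.tabulate (λ y∈css same →
               Unique⇒disjoint c (unique d) (SameCycle⇒∈ (All.head (cycles d)) x∈c same) y∈css))) ⟩
      length (c ++ [])
        ≡⟨ cong length (++-identityʳ c) ⟩
      length c ∎
      where
      open ≡-Reasoning
      same? = sameCycle? σ x

    -- The minimum of a block is its only point that passes the test, and the orbit of that point is
    -- the block. A block is never empty, so its head can serve as the default value of `min`.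
    cycleLengths-cycle : map (λ i → length (cycle σ i)) (filter (leastInCycle? σ) c) ≡ [ length c ]
    cycleLengths-cycle = least c refl
      where
      least : ∀ c′ → c ≡ c′ → map (λ i → length (cycle σ i)) (filter (leastInCycle? σ) c) ≡ [ length c ]
      least []       refl with () ← All.head (cycles d)
      least (x ∷ xs) refl = trans
        (cong (map _) (filter-unique (leastInCycle? σ) (Unique-++⁻ˡ c (unique d)) m∈c
          (λ y same → m≤ (SameCycle⇒∈ (All.head (cycles d)) m∈c same))
          (λ y∈c y-least → Fin.≤-antisym (y-least m (∈⇒SameCycle y∈c m∈c)) (m≤ y∈c))))
        (cong [_] (length-cycle m∈c))
        where
        m = min (Fin.≤-totalOrder n) x xs
        m∈c : m ∈ x ∷ xs
        m∈c = [ here , there ]′ (argmin-sel (Fin.≤-totalOrder n) id x xs)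
        m≤ : ∀ {y} → y ∈ x ∷ xs → m Fin.≤ y
        m≤ (here refl) = min≤⊤ (Fin.≤-totalOrder n) x xs
        m≤ (there y∈)  = All.lookup (min≤xs (Fin.≤-totalOrder n) x xs) y∈

  -- Both the filter and the map act block by block on `concat css`, and any block can be moved to
  -- the front, where the result for a first block applies.
  cycleLengths-↭ : ∀ {css} → Decomposition σ css → cycleLengths σ ↭ map length css
  cycleLengths-↭ {css} d = ↭-trans
    (map⁺ _ (filter-↭ (leastInCycle? σ) (↭-sym (complete d))))
    (↭-reflexive (go css (All.tabulate λ c∈css →
      cycleLengths-cycle (Decomposition-resp-↭ (proj₂ (∈⇒↭∷ c∈css)) d))))
    where
    g : List (Fin n) → List ℕ
    g xs = map (λ i → length (cycle σ i)) (filter (leastInCycle? σ) xs)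
    go : ∀ dss → All (λ c → g c ≡ [ length c ]) dss → g (concat dss) ≡ map length dss
    go []        []         = refl
    go (c ∷ dss) (eq ∷ eqs) = begin
      g (c ++ concat dss)     ≡⟨ cong (map _) (filter-++ (leastInCycle? σ) c (concat dss)) ⟩
      map _ (filter (leastInCycle? σ) c ++ filter (leastInCycle? σ) (concat dss))
                              ≡⟨ map-++ _ (filter (leastInCycle? σ) c) _ ⟩
      g c ++ g (concat dss)   ≡⟨ cong₂ _++_ eq (go dss eqs) ⟩
      length c ∷ map length dss ∎
      where open ≡-Reasoning

-- Multiplication by a transposition joins two cycles or splits one

transpose-left : ∀ (i j : Fin n) → transpose i j ⟨$⟩ʳ i ≡ j
transpose-left i j rewrite dec-true (i Fin.≟ i) refl = refl

transpose-right : ∀ (i j : Fin n) → transpose i j ⟨$⟩ʳ j ≡ i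
transpose-right i j with j Fin.≟ i
... | yes j≡i = j≡i
... | no  _ rewrite dec-true (j Fin.≟ j) refl = refl

transpose-other : ∀ {i j k : Fin n} → k ≢ i → k ≢ j → transpose i j ⟨$⟩ʳ k ≡ k
transpose-other {i = i} {j} {k} k≢i k≢j
  rewrite dec-false (k Fin.≟ i) k≢i | dec-false (k Fin.≟ j) k≢j = refl

module _ (σ : Permutation′ n) (x y : Fin n) where

  private
    τ = σ · transpose y x

    τx≡σy : σ ⟨$⟩ʳ y ≡ τ ⟨$⟩ʳ x
    τx≡σy = cong (σ ⟨$⟩ʳ_) (sym (transpose-right y x))

    τy≡σx : σ ⟨$⟩ʳ x ≡ τ ⟨$⟩ʳ y
    τy≡σx = cong (σ ⟨$⟩ʳ_) (sym (transpose-left y x))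

  unchanged : ∀ {zs} → x ∷ y ∷ zs ↭ allFin n → All (λ z → σ ⟨$⟩ʳ z ≡ τ ⟨$⟩ʳ z) zs
  unchanged p with (_ ∷ x∉) ∷ y∉ ∷ _ ← Unique-resp-↭ (↭-sym p) (Unique.allFin⁺ n) =
    All.zipWith (λ (x≢z , y≢z) → cong (σ ⟨$⟩ʳ_) (sym (transpose-other (y≢z ∘ sym) (x≢z ∘ sym)))) (x∉ , y∉)

  private
    bring : ∀ xs {ys zs} → (xs ++ y ∷ ys) ++ zs ↭ y ∷ xs ++ ys ++ zs
    bring xs {ys} {zs} = ↭-trans (↭-reflexive (++-assoc xs (y ∷ ys) zs)) (shift y xs (ys ++ zs))

    unchanged-++ : ∀ xs ys {css} → x ∷ y ∷ xs ++ ys ++ concat css ↭ allFin n →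
      All (IsCycle (σ ⟨$⟩ʳ_)) css →
      All (λ z → σ ⟨$⟩ʳ z ≡ τ ⟨$⟩ʳ z) xs × All (λ z → σ ⟨$⟩ʳ z ≡ τ ⟨$⟩ʳ z) ys × All (IsCycle (τ ⟨$⟩ʳ_)) css
    unchanged-++ xs ys p cs
      with xs= , eqs ← All.++⁻ xs (unchanged p)
      with ys= , css= ← All.++⁻ ys eqs
      = xs= , ys= , All.zipWith (λ (eqs , c) → IsCycle-cong eqs c) (All.concat⁻ css= , cs)

  -- `τ` exchanges the images of `x` and `y`. So `x` is now followed by `ys`, which leads back to
  -- `x`, and `y` by `xs`, which leads to `y`.
  split : ∀ xs {ys css} → Decomposition σ ((x ∷ xs ++ y ∷ ys) ∷ css) →
          Decomposition τ ((x ∷ ys) ∷ (y ∷ xs) ∷ css)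
  split xs {ys} {css} (decomposition (c ∷ cs) com)
    with p , q ← Path-++⁻ xs c
    with com′ ← ↭-trans (↭.prep x (↭-sym (bring xs))) com
    with xs= , ys= , cs′ ← unchanged-++ xs ys com′ cs
    = decomposition
        (Path-cong ys τx≡σy ys= q ∷ Path-cong xs τy≡σx xs= p ∷ cs′)
        (↭-trans (↭.prep x (↭-trans (shift y ys (xs ++ concat css)) (↭.prep y (shifts ys xs)))) com′)

  -- After the exchange of images, `x` is followed by `ys`, which ends in `y`, and `y` by `xs`,
  -- which ends in `x`: one closed path.
  join : ∀ {xs ys css} → Decomposition σ ((x ∷ xs) ∷ (y ∷ ys) ∷ css) →
         Decomposition τ ((x ∷ ys ++ y ∷ xs) ∷ css)
  join {xs} {ys} {css} (decomposition (p ∷ q ∷ cs) com)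
    with com′ ← ↭-trans (↭.prep x (↭-sym (shift y xs (ys ++ concat css)))) com
    with xs= , ys= , cs′ ← unchanged-++ xs ys com′ cs
    = decomposition
        (Path-++⁺ ys (Path-cong ys τx≡σy ys= q) (Path-cong xs τy≡σx xs= p) ∷ cs′)
        (↭-trans (↭.prep x (↭-trans (bring ys) (↭.prep y (shifts ys xs)))) com′)

-- The embedding of Sₙ into Sₙ₊₁

transpose-involutive : ∀ (i j k : Fin n) → transpose i j ⟨$⟩ʳ (transpose i j ⟨$⟩ʳ k) ≡ k
transpose-involutive i j k = by-cases (k Fin.≟ i) (k Fin.≟ j)
  where
  by-cases : Dec (k ≡ i) → Dec (k ≡ j) → transpose i j ⟨$⟩ʳ (transpose i j ⟨$⟩ʳ k) ≡ k
  by-cases (yes refl) _          = trans (cong (transpose k j ⟨$⟩ʳ_) (transpose-left k j)) (transpose-right k j)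
  by-cases (no _)     (yes refl) = trans (cong (transpose i k ⟨$⟩ʳ_) (transpose-right i k)) (transpose-left i k)
  by-cases (no k≢i)   (no k≢j)   = trans (cong (transpose i j ⟨$⟩ʳ_) (transpose-other k≢i k≢j)) (transpose-other k≢i k≢j)

punchIn-fromℕ : ∀ (i : Fin n) → punchIn (fromℕ n) i ≡ inject₁ i
punchIn-fromℕ Fin.zero    = refl
punchIn-fromℕ (Fin.suc i) = cong Fin.suc (punchIn-fromℕ i)

embed : Permutation′ n → Permutation′ (suc n)
embed {n} = insert (fromℕ n) (fromℕ n)

module _ (σ : Permutation′ n) where

  embed-inject₁ : ∀ i → embed σ ⟨$⟩ʳ inject₁ i ≡ inject₁ (σ ⟨$⟩ʳ i)
  embed-inject₁ i = begin
    embed σ ⟨$⟩ʳ inject₁ i            ≡⟨ cong (embed σ ⟨$⟩ʳ_) (punchIn-fromℕ i) ⟨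
    embed σ ⟨$⟩ʳ punchIn (fromℕ n) i  ≡⟨ insert-punchIn (fromℕ n) (fromℕ n) σ i ⟩
    punchIn (fromℕ n) (σ ⟨$⟩ʳ i)      ≡⟨ punchIn-fromℕ (σ ⟨$⟩ʳ i) ⟩
    inject₁ (σ ⟨$⟩ʳ i)                ∎
    where open ≡-Reasoning

  embed-fromℕ : embed σ ⟨$⟩ʳ fromℕ n ≡ fromℕ n
  embed-fromℕ with fromℕ n Fin.≟ fromℕ n
  ... | yes _ = refl
  ... | no ≢  = contradiction refl ≢

-- The values on the old points and on the last one determine a permutation. Compatibility of
-- `embed` with `_≈_`, the identity, products and transpositions is checked through this criterion.
≈-embed : ∀ (σ : Permutation′ n) (τ : Permutation′ (suc n)) →
  (∀ i → τ ⟨$⟩ʳ inject₁ i ≡ inject₁ (σ ⟨$⟩ʳ i)) → τ ⟨$⟩ʳ fromℕ n ≡ fromℕ n → embed σ Perm.≈ τ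
≈-embed σ τ τ-inject₁ τ-fromℕ i with view i
... | ‵fromℕ     = trans (embed-fromℕ σ) (sym τ-fromℕ)
... | ‵inject₁ j = trans (embed-inject₁ σ j) (sym (τ-inject₁ j))

embed-injective : ∀ {σ τ : Permutation′ n} → embed σ Perm.≈ embed τ → σ Perm.≈ τ
embed-injective {σ = σ} {τ} σ≈τ i = Fin.inject₁-injective
  (trans (sym (embed-inject₁ σ i)) (trans (σ≈τ (inject₁ i)) (embed-inject₁ τ i)))

embed-cong : ∀ {σ τ : Permutation′ n} → σ Perm.≈ τ → embed σ Perm.≈ embed τ
embed-cong {σ = σ} {τ} σ≈τ = ≈-embed σ (embed τ)
  (λ i → trans (embed-inject₁ τ i) (cong inject₁ (sym (σ≈τ i)))) (embed-fromℕ τ)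

embed-id : embed {n} Perm.id Perm.≈ Perm.id
embed-id = ≈-embed Perm.id Perm.id (λ _ → refl) refl

embed-· : ∀ (σ τ : Permutation′ n) → embed (σ · τ) Perm.≈ embed σ · embed τ
embed-· σ τ = ≈-embed (σ · τ) (embed σ · embed τ)
  (λ i → trans (cong (embed σ ⟨$⟩ʳ_) (embed-inject₁ τ i)) (embed-inject₁ σ _))
  (trans (cong (embed σ ⟨$⟩ʳ_) (embed-fromℕ τ)) (embed-fromℕ σ))

embed-transpose : ∀ (i j : Fin n) → embed (transpose i j) Perm.≈ transpose (inject₁ i) (inject₁ j)
embed-transpose i j = ≈-embed (transpose i j) (transpose (inject₁ i) (inject₁ j)) on-inject₁
  (transpose-other Fin.fromℕ≢inject₁ Fin.fromℕ≢inject₁)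
  where
  on-inject₁ : ∀ k → transpose (inject₁ i) (inject₁ j) ⟨$⟩ʳ inject₁ k ≡ inject₁ (transpose i j ⟨$⟩ʳ k)
  on-inject₁ k = by-cases (k Fin.≟ i) (k Fin.≟ j)
    where
    by-cases : Dec (k ≡ i) → Dec (k ≡ j) →
      transpose (inject₁ i) (inject₁ j) ⟨$⟩ʳ inject₁ k ≡ inject₁ (transpose i j ⟨$⟩ʳ k)
    by-cases (yes refl) _          = trans (transpose-left (inject₁ k) (inject₁ j)) (cong inject₁ (sym (transpose-left k j)))
    by-cases (no _)     (yes refl) = trans (transpose-right (inject₁ i) (inject₁ k)) (cong inject₁ (sym (transpose-right i k)))
    by-cases (no k≢i)   (no k≢j)   = trans
      (transpose-other (k≢i ∘ Fin.inject₁-injective) (k≢j ∘ Fin.inject₁-injective))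
      (cong inject₁ (sym (transpose-other k≢i k≢j)))

tabulate-∷ʳ : ∀ (f : Fin (suc n) → A) → tabulate f ≡ tabulate (f ∘ inject₁) ∷ʳ f (fromℕ n)
tabulate-∷ʳ {zero}  f = refl
tabulate-∷ʳ {suc n} f = cong (f Fin.zero ∷_) (tabulate-∷ʳ (f ∘ Fin.suc))

allFin-∷ʳ : ∀ n → allFin (suc n) ≡ map inject₁ (allFin n) ∷ʳ fromℕ n
allFin-∷ʳ n = trans (tabulate-∷ʳ id) (cong (_∷ʳ fromℕ n) (sym (map-tabulate id inject₁)))

embed-decomposition : ∀ {σ : Permutation′ n} {css} → Decomposition σ css →
  Decomposition (embed σ) ([ fromℕ n ] ∷ map (map inject₁) css)
embed-decomposition {n} {σ} {css} (decomposition cs com) = decomposition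
  (embed-fromℕ σ ∷ All.map⁺ (All.map (λ {c} → IsCycle-map inject₁ (embed-inject₁ σ) {c}) cs))
  (begin
    fromℕ n ∷ concat (map (map inject₁) css) ≡⟨ cong (fromℕ n ∷_) (concat-map css) ⟩
    fromℕ n ∷ map inject₁ (concat css)       ↭⟨ ↭.prep _ (map⁺ inject₁ com) ⟩
    fromℕ n ∷ map inject₁ (allFin n)         ↭⟨ ∷↭∷ʳ _ _ ⟩
    map inject₁ (allFin n) ∷ʳ fromℕ n        ≡⟨ allFin-∷ʳ n ⟨
    allFin (suc n)                           ∎)
  where open PermutationReasoning

-- The recursion for the coefficients of hₖ at the Jucys-Murphy elements

∑ₗ-allFin-last : ∀ (f : Fin (suc n) → ℤ) →
  ∑ₗ (allFin (suc n)) f ≡ ∑ₗ (allFin n) (f ∘ inject₁) + f (fromℕ n)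
∑ₗ-allFin-last {n} f = begin
  ∑ₗ (allFin (suc n)) f                           ≡⟨ cong (λ is → ∑ₗ is f) (allFin-∷ʳ n) ⟩
  ∑ₗ (map inject₁ (allFin n) ∷ʳ fromℕ n) f        ≡⟨ ∑ₗ-++ (map inject₁ (allFin n)) _ ⟩
  ∑ₗ (map inject₁ (allFin n)) f + (f (fromℕ n) + 0ℤ)
    ≡⟨ cong₂ _+_ (∑ₗ-map inject₁ (allFin n)) (+-identityʳ (f (fromℕ n))) ⟩
  ∑ₗ (allFin n) (f ∘ inject₁) + f (fromℕ n)       ∎
  where open ≡-Reasoning

⟨JM∣⟩ : ∀ (i : Fin n) {f} →
  ⟨ JM i ∣ f ⟩ ≡ ∑ₗ (allFin n) (λ j → 𝟙 (j Fin.<? i) * f (transpose j i))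
⟨JM∣⟩ {n} i {f} = begin
  ⟨ JM i ∣ f ⟩                                              ≡⟨ ⟨sumOf∣⟩ (map (λ j → transpose j i) js) ⟩
  ∑ₗ (map (λ j → transpose j i) js) f                       ≡⟨ ∑ₗ-map _ js ⟩
  ∑ₗ js (λ j → f (transpose j i))                           ≡⟨ ∑ₗ-filter (Fin._<? i) (allFin n) ⟩
  ∑ₗ (allFin n) (λ j → 𝟙 (j Fin.<? i) * f (transpose j i))  ∎
  where
  open ≡-Reasoning
  js = filter (Fin._<? i) (allFin n)

⟨JM-fromℕ∣⟩ : ∀ n {f} →
  ⟨ JM (fromℕ n) ∣ f ⟩ ≡ ∑ₗ (allFin n) (λ j → f (transpose (inject₁ j) (fromℕ n)))
⟨JM-fromℕ∣⟩ n {f} = begin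
  ⟨ JM (fromℕ n) ∣ f ⟩
    ≡⟨ ⟨JM∣⟩ (fromℕ n) ⟩
  ∑ₗ (allFin (suc n)) g
    ≡⟨ ∑ₗ-allFin-last g ⟩
  ∑ₗ (allFin n) (g ∘ inject₁) + g (fromℕ n)
    ≡⟨ cong₂ _+_ (∑ₗ-cong (allFin n) (λ j → trans
         (cong (_* f (transpose (inject₁ j) (fromℕ n))) (𝟙-true (inject₁ j Fin.<? fromℕ n) (inject₁<fromℕ j)))
         (*-identityˡ _)))
       (cong (_* f (transpose (fromℕ n) (fromℕ n))) (𝟙-false (fromℕ n Fin.<? fromℕ n) (ℕ.<-irrefl refl))) ⟩
  ∑ₗ (allFin n) (λ j → f (transpose (inject₁ j) (fromℕ n))) + 0ℤ
    ≡⟨ +-identityʳ _ ⟩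
  ∑ₗ (allFin n) (λ j → f (transpose (inject₁ j) (fromℕ n))) ∎
  where
  open ≡-Reasoning
  g : Fin (suc n) → ℤ
  g j = 𝟙 (j Fin.<? fromℕ n) * f (transpose j (fromℕ n))
  inject₁<fromℕ : ∀ j → inject₁ j Fin.< fromℕ n
  inject₁<fromℕ j = subst₂ ℕ._<_ (sym (Fin.toℕ-inject₁ j)) (sym (Fin.toℕ-fromℕ n)) (Fin.toℕ<n j)

-- The sum defining a Jucys-Murphy element runs over smaller indices only, so the new top index
-- contributes nothing and the remaining transpositions are embedded ones.
⟨JM-inject₁∣⟩ : ∀ (i : Fin n) {f} → Extensional f → ⟨ JM (inject₁ i) ∣ f ⟩ ≡ ⟨ JM i ∣ f ∘ embed ⟩
⟨JM-inject₁∣⟩ {n} i {f} f-ext = begin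
  ⟨ JM (inject₁ i) ∣ f ⟩
    ≡⟨ ⟨JM∣⟩ (inject₁ i) ⟩
  ∑ₗ (allFin (suc n)) g
    ≡⟨ ∑ₗ-allFin-last g ⟩
  ∑ₗ (allFin n) (g ∘ inject₁) + g (fromℕ n)
    ≡⟨ cong₂ _+_ (∑ₗ-cong (allFin n) (λ j → cong₂ _*_
         (𝟙-cong (subst₂ ℕ._<_ (Fin.toℕ-inject₁ j) (Fin.toℕ-inject₁ i))
                 (subst₂ ℕ._<_ (sym (Fin.toℕ-inject₁ j)) (sym (Fin.toℕ-inject₁ i)))
                 (inject₁ j Fin.<? inject₁ i) (j Fin.<? i))
         (f-ext (λ k → sym (embed-transpose j i k)))))
       (cong (_* f (transpose (fromℕ n) (inject₁ i))) (𝟙-false (fromℕ n Fin.<? inject₁ i) fromℕ≮inject₁)) ⟩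
  ∑ₗ (allFin n) (λ j → 𝟙 (j Fin.<? i) * f (embed (transpose j i))) + 0ℤ
    ≡⟨ +-identityʳ _ ⟩
  ∑ₗ (allFin n) (λ j → 𝟙 (j Fin.<? i) * f (embed (transpose j i)))
    ≡⟨ ⟨JM∣⟩ i ⟨
  ⟨ JM i ∣ f ∘ embed ⟩ ∎
  where
  open ≡-Reasoning
  g : Fin (suc n) → ℤ
  g j = 𝟙 (j Fin.<? inject₁ i) * f (transpose j (inject₁ i))
  fromℕ≮inject₁ : ¬ fromℕ n Fin.< inject₁ i
  fromℕ≮inject₁ n<i = ℕ.<-asym (Fin.toℕ<n i)
    (subst₂ ℕ._<_ (Fin.toℕ-fromℕ n) (Fin.toℕ-inject₁ i) n<i)

⟨word-inject₁∣⟩ : ∀ (is : List (Fin n)) {f} → Extensional f →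
  ⟨ word (map (JM ∘ inject₁) is) ∣ f ⟩ ≡ ⟨ word (map JM is) ∣ f ∘ embed ⟩
-- The pairing with `one` unfolds to `1ℤ * c + 0ℤ`, where `c` is the value at the identity.
⟨word-inject₁∣⟩ []       {f} f-ext = cong (λ c → 1ℤ * c + 0ℤ) (f-ext (λ i → sym (embed-id i)))
⟨word-inject₁∣⟩ (i ∷ is) {f} f-ext = begin
  ⟨ JM (inject₁ i) ⊛ word (map (JM ∘ inject₁) is) ∣ f ⟩
    ≡⟨ ⟨⊛∣⟩ (JM (inject₁ i)) (word (map (JM ∘ inject₁) is)) ⟩
  ⟨ JM (inject₁ i) ∣ (λ τ → ⟨ word (map (JM ∘ inject₁) is) ∣ (λ υ → f (τ · υ)) ⟩) ⟩
    ≡⟨ ⟨JM-inject₁∣⟩ i (λ τ≈τ′ → ⟨∣⟩-cong (word (map (JM ∘ inject₁) is)) (λ υ → f-ext (λ k → τ≈τ′ (υ ⟨$⟩ʳ k)))) ⟩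
  ⟨ JM i ∣ (λ τ → ⟨ word (map (JM ∘ inject₁) is) ∣ (λ υ → f (embed τ · υ)) ⟩) ⟩
    ≡⟨ ⟨∣⟩-cong (JM i) (λ τ → ⟨word-inject₁∣⟩ is (λ υ≈υ′ → f-ext (λ k → cong (embed τ ⟨$⟩ʳ_) (υ≈υ′ k)))) ⟩
  ⟨ JM i ∣ (λ τ → ⟨ word (map JM is) ∣ (λ υ → f (embed τ · embed υ)) ⟩) ⟩
    ≡⟨ ⟨∣⟩-cong (JM i) (λ τ → ⟨∣⟩-cong (word (map JM is)) (λ υ → f-ext (λ k → sym (embed-· τ υ k)))) ⟩
  ⟨ JM i ∣ (λ τ → ⟨ word (map JM is) ∣ (λ υ → f (embed (τ · υ))) ⟩) ⟩
    ≡⟨ ⟨⊛∣⟩ (JM i) (word (map JM is)) ⟨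
  ⟨ word (map JM (i ∷ is)) ∣ f ∘ embed ⟩ ∎
  where open ≡-Reasoning

hᴶ : ∀ n → ℕ → ℤ[S n ]
hᴶ n k = h k (map JM (allFin n))

⟨h-inject₁∣⟩ : ∀ n k {f} → Extensional f →
  ⟨ h k (map (JM ∘ inject₁) (allFin n)) ∣ f ⟩ ≡ ⟨ hᴶ n k ∣ f ∘ embed ⟩
⟨h-inject₁∣⟩ n k {f} f-ext = begin
  ⟨ h k (map (JM ∘ inject₁) (allFin n)) ∣ f ⟩
    ≡⟨ ⟨h∣⟩ k _ ⟩
  ∑ₗ (monomials k (map (JM ∘ inject₁) (allFin n))) (λ w → ⟨ word w ∣ f ⟩)
    ≡⟨ cong (λ ws → ∑ₗ ws (λ w → ⟨ word w ∣ f ⟩)) (monomials-map k (JM ∘ inject₁) (allFin n)) ⟩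
  ∑ₗ (map (map (JM ∘ inject₁)) M) (λ w → ⟨ word w ∣ f ⟩)
    ≡⟨ ∑ₗ-map (map (JM ∘ inject₁)) M ⟩
  ∑ₗ M (λ is → ⟨ word (map (JM ∘ inject₁) is) ∣ f ⟩)
    ≡⟨ ∑ₗ-cong M (λ is → ⟨word-inject₁∣⟩ is f-ext) ⟩
  ∑ₗ M (λ is → ⟨ word (map JM is) ∣ f ∘ embed ⟩)
    ≡⟨ ∑ₗ-map (map JM) M ⟨
  ∑ₗ (map (map JM) M) (λ w → ⟨ word w ∣ f ∘ embed ⟩)
    ≡⟨ cong (λ ws → ∑ₗ ws (λ w → ⟨ word w ∣ f ∘ embed ⟩)) (monomials-map k JM (allFin n)) ⟨
  ∑ₗ (monomials k (map JM (allFin n))) (λ w → ⟨ word w ∣ f ∘ embed ⟩)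
    ≡⟨ ⟨h∣⟩ k (map JM (allFin n)) ⟨
  ⟨ hᴶ n k ∣ f ∘ embed ⟩ ∎
  where
  open ≡-Reasoning
  M = monomials k (allFin n)

coeff-hᴶ-suc : ∀ n k (σ : Permutation′ (suc n)) →
  coeff σ (hᴶ (suc n) (suc k)) ≡
  ⟨ hᴶ n (suc k) ∣ (λ τ → [ embed τ ≈ σ ]) ⟩ +
  ∑ₗ (allFin n) (λ j → coeff (σ · transpose (inject₁ j) (fromℕ n)) (hᴶ (suc n) k))
coeff-hᴶ-suc n k σ = begin
  coeff σ (hᴶ (suc n) (suc k))
    ≡⟨ coeff≡⟨∣⟩ σ (hᴶ (suc n) (suc k)) ⟩
  ⟨ hᴶ (suc n) (suc k) ∣ [_≈ σ ] ⟩
    ≡⟨ cong (λ xs → ⟨ h (suc k) xs ∣ [_≈ σ ] ⟩) JMs ⟩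
  ⟨ h (suc k) (Js ∷ʳ JM (fromℕ n)) ∣ [_≈ σ ] ⟩
    ≡⟨ ⟨h-∷ʳ∣⟩ k Js (JM (fromℕ n)) (λ {τ} {υ} → [≈]-extensional σ {τ} {υ}) ⟩
  ⟨ h (suc k) Js ∣ [_≈ σ ] ⟩ + ⟨ h k (Js ∷ʳ JM (fromℕ n)) ∣ (λ τ → ⟨ JM (fromℕ n) ∣ (λ υ → [ τ · υ ≈ σ ]) ⟩) ⟩
    ≡⟨ cong₂ _+_ (⟨h-inject₁∣⟩ n (suc k) (λ {τ} {υ} → [≈]-extensional σ {τ} {υ}))
                 (cong (λ xs → ⟨ h k xs ∣ (λ τ → ⟨ JM (fromℕ n) ∣ (λ υ → [ τ · υ ≈ σ ]) ⟩) ⟩) (sym JMs)) ⟩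
  E + ⟨ hᴶ (suc n) k ∣ (λ τ → ⟨ JM (fromℕ n) ∣ (λ υ → [ τ · υ ≈ σ ]) ⟩) ⟩
    ≡⟨ cong (_+_ E) (⟨∣⟩-cong (hᴶ (suc n) k) (λ τ → ⟨JM-fromℕ∣⟩ n {λ υ → [ τ · υ ≈ σ ]})) ⟩
  E + ⟨ hᴶ (suc n) k ∣ (λ τ → ∑ₗ (allFin n) (λ j → [ τ · t j ≈ σ ])) ⟩
    ≡⟨ cong (_+_ E) (⟨∣⟩-∑ₗ (hᴶ (suc n) k) (allFin n) {λ j τ → [ τ · t j ≈ σ ]}) ⟩
  E + ∑ₗ (allFin n) (λ j → ⟨ hᴶ (suc n) k ∣ (λ τ → [ τ · t j ≈ σ ]) ⟩)
    ≡⟨ cong (_+_ E) (∑ₗ-cong (allFin n) (λ j → trans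
         (⟨∣⟩-cong (hᴶ (suc n) k) (λ τ → move τ j))
         (sym (coeff≡⟨∣⟩ (σ · t j) (hᴶ (suc n) k))))) ⟩
  E + ∑ₗ (allFin n) (λ j → coeff (σ · t j) (hᴶ (suc n) k)) ∎
  where
  open ≡-Reasoning
  Js = map (JM ∘ inject₁) (allFin n)
  E  = ⟨ hᴶ n (suc k) ∣ (λ τ → [ embed τ ≈ σ ]) ⟩

  t : Fin n → Permutation′ (suc n)
  t j = transpose (inject₁ j) (fromℕ n)

  JMs : map JM (allFin (suc n)) ≡ Js ∷ʳ JM (fromℕ n)
  JMs = trans (cong (map JM) (allFin-∷ʳ n))
    (trans (map-++ JM (map inject₁ (allFin n)) [ fromℕ n ])
           (cong (_∷ʳ JM (fromℕ n)) (sym (map-∘ (allFin n)))))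

  -- A transposition is its own inverse, so the right factor `t j` passes to the other side of the
  -- comparison unchanged.
  move : ∀ τ j → [ τ · t j ≈ σ ] ≡ [ τ ≈ σ · t j ]
  move τ j = 𝟙-cong
    (λ τt≈σ i → trans (cong (τ ⟨$⟩ʳ_) (sym (tt≈id i))) (τt≈σ (t j ⟨$⟩ʳ i)))
    (λ τ≈σt i → trans (τ≈σt (t j ⟨$⟩ʳ i)) (cong (σ ⟨$⟩ʳ_) (tt≈id i)))
    ((τ · t j) ≈? σ) (τ ≈? (σ · t j))
    where tt≈id = transpose-involutive (inject₁ j) (fromℕ n)

⟨∣embed≈embed⟩ : ∀ (x : ℤ[S n ]) σ → ⟨ x ∣ (λ τ → [ embed τ ≈ embed σ ]) ⟩ ≡ coeff σ x
⟨∣embed≈embed⟩ x σ = trans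
  (⟨∣⟩-cong x (λ τ → 𝟙-cong embed-injective embed-cong (embed τ ≈? embed σ) (τ ≈? σ)))
  (sym (coeff≡⟨∣⟩ σ x))

⟨∣embed≈⟩≡0 : ∀ (x : ℤ[S n ]) {σ} → σ ⟨$⟩ʳ fromℕ n ≢ fromℕ n → ⟨ x ∣ (λ τ → [ embed τ ≈ σ ]) ⟩ ≡ 0ℤ
⟨∣embed≈⟩≡0 x {σ} σn≢n = trans
  (∑ₗ-cong x (λ (c , τ) → trans
    (cong (c *_) (𝟙-false (embed τ ≈? σ) (λ τ≈σ → σn≢n (trans (sym (τ≈σ _)) (embed-fromℕ τ)))))
    (*-zeroʳ c)))
  (∑ₗ-zero x)

-- Enumeration of permutations

insert-zero-cong : ∀ j {π ρ : Permutation′ n} → π Perm.≈ ρ → insert Fin.zero j π Perm.≈ insert Fin.zero j ρ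
insert-zero-cong j             π≈ρ Fin.zero    = refl
insert-zero-cong j {π} {ρ} π≈ρ (Fin.suc i) = trans (insert-punchIn Fin.zero j π i)
  (trans (cong (punchIn j) (π≈ρ i)) (sym (insert-punchIn Fin.zero j ρ i)))

-- In `insert Fin.zero j π` the index `j` is the value at zero, so only `j = σ₀` can match `σ`; what
-- then remains to be matched is `σ` with zero removed.
∑ₗ-permutations : ∀ n (σ : Permutation′ n) → ∑ₗ (permutations n) [_≈ σ ] ≡ 1ℤ
∑ₗ-permutations zero    σ = cong (_+ 0ℤ) (𝟙-true (Perm.id ≈? σ) λ ())
∑ₗ-permutations (suc n) σ = begin
  ∑ₗ (permutations (suc n)) [_≈ σ ]
    ≡⟨ ∑ₗ-cartesianProductWith (insert Fin.zero) (allFin (suc n)) (permutations n) ⟩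
  ∑ₗ (allFin (suc n)) (λ j → ∑ₗ (permutations n) (λ π → [ insert Fin.zero j π ≈ σ ]))
    ≡⟨ ∑ₗ-only (Unique.allFin⁺ (suc n)) (∈-allFin σ₀) (λ {j} j≢ → trans
         (∑ₗ-cong (permutations n) (λ π → 𝟙-false (insert Fin.zero j π ≈? σ) (λ eq → j≢ (eq Fin.zero))))
         (∑ₗ-zero (permutations n))) ⟩
  ∑ₗ (permutations n) (λ π → [ insert Fin.zero σ₀ π ≈ σ ])
    ≡⟨ ∑ₗ-cong (permutations n) (λ π → 𝟙-cong (to π) (from π) (insert Fin.zero σ₀ π ≈? σ) (π ≈? σ⁻)) ⟩
  ∑ₗ (permutations n) [_≈ σ⁻ ]
    ≡⟨ ∑ₗ-permutations n σ⁻ ⟩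
  1ℤ ∎
  where
  open ≡-Reasoning
  σ₀ = σ ⟨$⟩ʳ Fin.zero
  σ⁻ = remove Fin.zero σ

  from : ∀ π → π Perm.≈ σ⁻ → insert Fin.zero σ₀ π Perm.≈ σ
  from π eq i = trans (insert-zero-cong σ₀ {π} {σ⁻} eq i) (insert-remove Fin.zero σ i)

  to : ∀ π → insert Fin.zero σ₀ π Perm.≈ σ → π Perm.≈ σ⁻
  to π eq i = Fin.punchIn-injective σ₀ _ _ (begin
    punchIn σ₀ (π ⟨$⟩ʳ i)                   ≡⟨ insert-punchIn Fin.zero σ₀ π i ⟨
    insert Fin.zero σ₀ π ⟨$⟩ʳ Fin.suc i     ≡⟨ eq (Fin.suc i) ⟩
    σ ⟨$⟩ʳ Fin.suc i                        ≡⟨ insert-remove Fin.zero σ (Fin.suc i) ⟨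
    insert Fin.zero σ₀ σ⁻ ⟨$⟩ʳ Fin.suc i    ≡⟨ insert-punchIn Fin.zero σ₀ σ⁻ i ⟩
    punchIn σ₀ (σ⁻ ⟨$⟩ʳ i)                  ∎)

-- Enumeration of partitions

open InsertionSort ≥-decTotalOrder using (insertionSort)
open SortingAlgorithm insertionSort using (sort-↭)

-- A sorted list is determined by its multiset. The sortedness fields are irrelevant, so usable
-- proofs are recovered from decidability.
Partition-≡ : ∀ {ρ ρ′ : Partition} → parts ρ ↭ parts ρ′ → ρ ≡ ρ′
Partition-≡ {partition xs xs↗ _} {partition ys ys↗ _} xs↭ys
  with refl ← ≋⇒≡ (↗↭↗⇒≋ (DecTotalOrder.totalOrder ≥-decTotalOrder)
         (recompute (linked? ℕ._≥?_ xs) xs↗) (recompute (linked? ℕ._≥?_ ys) ys↗) (↭⇒↭ₛ xs↭ys))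
  = refl

asPartition-parts : ∀ ρ → asPartition (parts ρ) ≡ just ρ
asPartition-parts (partition xs xs↗ pos) with linked? ℕ._≥?_ xs ×-dec all? ℕ.nonZero? xs
... | yes _ = refl
... | no ¬p = ⊥-elim-irr (¬p (xs↗ , pos))

asPartition-just : ∀ xs {ρ} → asPartition xs ≡ just ρ → parts ρ ≡ xs
asPartition-just xs eq with linked? ℕ._≥?_ xs ×-dec all? ℕ.nonZero? xs
asPartition-just xs refl | yes _ = refl

monomials-length : ∀ k (xs : List A) {w} → w ∈ monomials k xs → length w ≡ k
monomials-length zero    xs       (here refl) = refl
monomials-length (suc k) (x ∷ xs) w∈ with ∈-++⁻ (map (x ∷_) (monomials k (x ∷ xs))) w∈
... | inj₂ w∈ʳ = monomials-length (suc k) xs w∈ʳ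
... | inj₁ w∈ˡ with v , v∈ , refl ← ∈-map⁻ (x ∷_) w∈ˡ = cong suc (monomials-length k (x ∷ xs) v∈)

monomials-head : ∀ k (xs : List A) {v w} → v ∷ w ∈ monomials k xs → v ∈ xs
monomials-head zero    xs       (here ())
monomials-head (suc k) (x ∷ xs) w∈ with ∈-++⁻ (map (x ∷_) (monomials k (x ∷ xs))) w∈
... | inj₂ w∈ʳ = there (monomials-head (suc k) xs w∈ʳ)
... | inj₁ w∈ˡ with _ , _ , refl ← ∈-map⁻ (x ∷_) w∈ˡ = here refl

monomials-unique : ∀ k {xs : List A} → Unique xs → Unique (monomials k xs)
monomials-unique zero    xs!          = [] ∷ []
monomials-unique (suc k) []           = []
monomials-unique (suc k) {x ∷ xs} x∷xs!@(x∉xs ∷ xs!) = Unique.++⁺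
  (Unique.map⁺ ∷-injectiveʳ (monomials-unique k x∷xs!))
  (monomials-unique (suc k) xs!)
  disjoint
  where
  disjoint : Disjoint (map (x ∷_) (monomials k (x ∷ xs))) (monomials (suc k) xs)
  disjoint (w∈ , w∈′) with _ , _ , refl ← ∈-map⁻ (x ∷_) w∈ =
    All.lookup x∉xs (monomials-head (suc k) xs w∈′) refl

-- The head is compared with the largest letter: if equal, it is taken and the alphabet kept, since
-- letters may repeat; if smaller, that letter is discarded, and the head bounds the tail.
∈-monomials-downFrom : ∀ m {xs} → AllPairs _≥_ xs → All (_< m) xs → xs ∈ monomials (length xs) (downFrom m)
∈-monomials-downFrom m       []           []          = here refl
∈-monomials-downFrom (suc m) {x ∷ xs} (x≥ ∷ xs↘) (x<1+m ∷ xs<)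
  with ∈-monomials-downFrom (suc m) xs↘ xs< | ℕ.m≤n⇒m<n∨m≡n (ℕ.s≤s⁻¹ x<1+m)
... | xs∈ | inj₂ refl = ∈-++⁺ˡ (∈-map⁺ (x ∷_) xs∈)
... | _   | inj₁ x<m  = ∈-++⁺ʳ (map (m ∷_) (monomials (length xs) (downFrom (suc m))))
  (∈-monomials-downFrom m (x≥ ∷ xs↘) (x<m ∷ All.map (λ y≤x → ℕ.≤-<-trans y≤x x<m) x≥))

All-≤-sum : ∀ xs → All (_≤ sum xs) xs
All-≤-sum []       = []
All-≤-sum (x ∷ xs) = ℕ.m≤m+n x (sum xs) ∷ All.map (λ y≤ → ℕ.≤-trans y≤ (ℕ.m≤n+m (sum xs) x)) (All-≤-sum xs)

length≤sum : ∀ {xs} → All NonZero xs → length xs ≤ sum xs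
length≤sum []                      = z≤n
length≤sum (_∷_ {x = suc x} _ pos) = s≤s (ℕ.≤-trans (length≤sum pos) (ℕ.m≤n+m _ x))

words : ℕ → List (List ℕ)
words n = concatMap (λ l → monomials l (downFrom (suc n))) (upTo (suc n))

words-unique : ∀ n → Unique (words n)
words-unique n = Unique.concat⁺
  (All.map⁺ (All.universal (λ l → monomials-unique l (Unique.downFrom⁺ (suc n))) (upTo (suc n))))
  (AllPairs.map⁺ (AllPairs.map disjoint (Unique.upTo⁺ (suc n))))
  where
  disjoint : ∀ {k l} → k ≢ l → Disjoint (monomials k (downFrom (suc n))) (monomials l (downFrom (suc n)))
  disjoint {k} {l} k≢l (w∈ , w∈′) = k≢l
    (trans (sym (monomials-length k _ w∈)) (monomials-length l _ w∈′))

-- Each part is at most the sum, and positive parts number at most their sum, so both the letters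
-- and the length are in range.
parts∈words : ∀ ρ → parts ρ ∈ words ∣ ρ ∣
parts∈words (partition xs xs↗ pos) = ∈-concat⁺′
  (∈-monomials-downFrom (suc (sum xs))
    (Linked⇒AllPairs (λ x≥y y≥z → ℕ.≤-trans y≥z x≥y) (recompute (linked? ℕ._≥?_ xs) xs↗))
    (All.map s≤s (All-≤-sum xs)))
  (∈-map⁺ (λ l → monomials l (downFrom (suc (sum xs))))
    (∈-upTo⁺ (s≤s (length≤sum (recompute (all? ℕ.nonZero? xs) pos)))))

∑ₗ-mapMaybe : ∀ (f : A → Maybe B) xs {g} → ∑ₗ (mapMaybe f xs) g ≡ ∑ₗ xs (λ x → maybe′ g 0ℤ (f x))
∑ₗ-mapMaybe f []       = refl
∑ₗ-mapMaybe f (x ∷ xs) {g} with f x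
... | just y  = cong (_+_ (g y)) (∑ₗ-mapMaybe f xs)
... | nothing = trans (∑ₗ-mapMaybe f xs) (sym (+-identityˡ _))

-- The sum is carried back to the words, which are known to be distinct: a word that is no partition
-- contributes zero, and a partition determines its word.
∑ₗ-partitions : ∀ ρ {f} → (∀ {ρ′} → ρ′ ≢ ρ → f ρ′ ≡ 0ℤ) → ∑ₗ (partitions ∣ ρ ∣) f ≡ f ρ
∑ₗ-partitions ρ {f} f≢ = begin
  ∑ₗ (partitions ∣ ρ ∣) f
    ≡⟨ ∑ₗ-filter (λ ρ′ → ∣ ρ′ ∣ ℕ.≟ ∣ ρ ∣) (mapMaybe asPartition (words ∣ ρ ∣)) ⟩
  ∑ₗ (mapMaybe asPartition (words ∣ ρ ∣)) g
    ≡⟨ ∑ₗ-mapMaybe asPartition (words ∣ ρ ∣) {g} ⟩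
  ∑ₗ (words ∣ ρ ∣) (λ w → maybe′ g 0ℤ (asPartition w))
    ≡⟨ ∑ₗ-only (words-unique ∣ ρ ∣) (parts∈words ρ) vanishes ⟩
  maybe′ g 0ℤ (asPartition (parts ρ))
    ≡⟨ cong (maybe′ g 0ℤ) (asPartition-parts ρ) ⟩
  g ρ
    ≡⟨ cong (_* f ρ) (𝟙-true (∣ ρ ∣ ℕ.≟ ∣ ρ ∣) refl) ⟩
  1ℤ * f ρ
    ≡⟨ *-identityˡ (f ρ) ⟩
  f ρ ∎
  where
  open ≡-Reasoning
  g : Partition → ℤ
  g ρ′ = 𝟙 (∣ ρ′ ∣ ℕ.≟ ∣ ρ ∣) * f ρ′

  vanishes : ∀ {w} → w ≢ parts ρ → maybe′ g 0ℤ (asPartition w) ≡ 0ℤ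
  vanishes {w} w≢ with asPartition w in eq
  ... | nothing = refl
  ... | just ρ′ = trans (cong (𝟙 (∣ ρ′ ∣ ℕ.≟ ∣ ρ ∣) *_)
    (f≢ (λ ρ′≡ρ → w≢ (trans (sym (asPartition-just w eq)) (cong parts ρ′≡ρ))))) (*-zeroʳ (𝟙 (∣ ρ′ ∣ ℕ.≟ ∣ ρ ∣)))

-- The coefficient of a permutation of cycle type ρ

record HasCycleType (σ : Permutation′ n) (ρ : Partition) : Set where
  constructor hasCycleType
  field
    {blocks}      : List (List (Fin n))
    decomp        : Decomposition σ blocks
    lengths       : map length blocks ↭ parts ρ

open HasCycleType using (decomp; lengths)

cycleType≡ : ∀ {σ : Permutation′ n} {ρ} → HasCycleType σ ρ → cycleType σ ≡ ρ
cycleType≡ {σ = σ} t = Partition-≡ (↭-trans (sort-↭ (cycleLengths σ))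
  (↭-trans (cycleLengths-↭ (decomp t)) (lengths t)))

length-concat : ∀ (xss : List (List A)) → length (concat xss) ≡ sum (map length xss)
length-concat []         = refl
length-concat (xs ∷ xss) = trans (length-++ xs) (cong (length xs ℕ.+_) (length-concat xss))

cycleType-size : ∀ {σ : Permutation′ n} {ρ} → HasCycleType σ ρ → ∣ ρ ∣ ≡ n
cycleType-size {n} {ρ = ρ} (hasCycleType {css} d lens) = begin
  sum (parts ρ)         ≡⟨ sum-↭ lens ⟨
  sum (map length css)  ≡⟨ length-concat css ⟨
  length (concat css)   ≡⟨ ↭-length (complete d) ⟩
  length (allFin n)     ≡⟨ length-tabulate id ⟩
  n                     ∎
  where open ≡-Reasoning

-- Only enumerated permutations equal to `σ` contribute. On these the cycle type is `ρ`, so the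
-- class indicator is a constant factor, and `σ` is enumerated once.
⟨𝒞∣⟩ : ∀ {σ : Permutation′ n} {ρ} → HasCycleType σ ρ → ∀ ρ′ → ⟨ 𝒞 n ρ′ ∣ [_≈ σ ] ⟩ ≡ 𝟙 (ρ ≟ ρ′)
⟨𝒞∣⟩ {n} {σ} {ρ} (hasCycleType d lens) ρ′ = begin
  ⟨ 𝒞 n ρ′ ∣ [_≈ σ ] ⟩
    ≡⟨ ⟨sumOf∣⟩ (filter (λ τ → cycleType τ ≟ ρ′) (permutations n)) ⟩
  ∑ₗ (filter (λ τ → cycleType τ ≟ ρ′) (permutations n)) [_≈ σ ]
    ≡⟨ ∑ₗ-filter (λ τ → cycleType τ ≟ ρ′) (permutations n) ⟩
  ∑ₗ (permutations n) (λ τ → 𝟙 (cycleType τ ≟ ρ′) * [ τ ≈ σ ])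
    ≡⟨ ∑ₗ-cong (permutations n) (λ τ → constant τ (τ ≈? σ)) ⟩
  ∑ₗ (permutations n) (λ τ → 𝟙 (ρ ≟ ρ′) * [ τ ≈ σ ])
    ≡⟨ *-distribˡ-∑ₗ (permutations n) (𝟙 (ρ ≟ ρ′)) ⟨
  𝟙 (ρ ≟ ρ′) * ∑ₗ (permutations n) [_≈ σ ]
    ≡⟨ cong (𝟙 (ρ ≟ ρ′) *_) (∑ₗ-permutations n σ) ⟩
  𝟙 (ρ ≟ ρ′) * 1ℤ
    ≡⟨ *-identityʳ (𝟙 (ρ ≟ ρ′)) ⟩
  𝟙 (ρ ≟ ρ′) ∎
  where
  open ≡-Reasoning
  constant : ∀ τ (τ≈?σ : Dec (τ Perm.≈ σ)) → 𝟙 (cycleType τ ≟ ρ′) * 𝟙 τ≈?σ ≡ 𝟙 (ρ ≟ ρ′) * 𝟙 τ≈?σ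
  constant τ (yes τ≈σ) = cong (λ ρ → 𝟙 (ρ ≟ ρ′) * 1ℤ)
    (cycleType≡ {σ = τ} {ρ} (hasCycleType (Decomposition-resp-≈ {σ = σ} {τ} (λ i → sym (τ≈σ i)) d) lens))
  constant τ (no _)    = trans (*-zeroʳ (𝟙 (cycleType τ ≟ ρ′))) (sym (*-zeroʳ (𝟙 (ρ ≟ ρ′))))

-- The bridge from the group algebra to `a`: a value of `a` is obtained by exhibiting any
-- permutation with a certified cycle type.
coeff-hᴶ : ∀ a → IsCoefficientFamily a → ∀ k {σ : Permutation′ n} {ρ} → HasCycleType σ ρ →
  coeff σ (hᴶ n k) ≡ a k ρ
coeff-hᴶ {n} a fam k {σ} {ρ} t = begin
  coeff σ (hᴶ n k)
    ≡⟨ fam n k σ ⟩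
  coeff σ (∑ (partitions n) (λ ρ′ → a k ρ′ • 𝒞 n ρ′))
    ≡⟨ coeff≡⟨∣⟩ σ (∑ (partitions n) (λ ρ′ → a k ρ′ • 𝒞 n ρ′)) ⟩
  ⟨ ∑ (partitions n) (λ ρ′ → a k ρ′ • 𝒞 n ρ′) ∣ [_≈ σ ] ⟩
    ≡⟨ ∑ₗ-concatMap (λ ρ′ → a k ρ′ • 𝒞 n ρ′) (partitions n) ⟩
  ∑ₗ (partitions n) (λ ρ′ → ⟨ a k ρ′ • 𝒞 n ρ′ ∣ [_≈ σ ] ⟩)
    ≡⟨ ∑ₗ-cong (partitions n) (λ ρ′ → trans (⟨•∣⟩ (a k ρ′) (𝒞 n ρ′)) (cong (a k ρ′ *_) (⟨𝒞∣⟩ t ρ′))) ⟩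
  ∑ₗ (partitions n) (λ ρ′ → a k ρ′ * 𝟙 (ρ ≟ ρ′))
    ≡⟨ cong (λ m → ∑ₗ (partitions m) (λ ρ′ → a k ρ′ * 𝟙 (ρ ≟ ρ′))) (cycleType-size t) ⟨
  ∑ₗ (partitions ∣ ρ ∣) (λ ρ′ → a k ρ′ * 𝟙 (ρ ≟ ρ′))
    ≡⟨ ∑ₗ-partitions ρ (λ {ρ′} ρ′≢ρ → trans (cong (a k ρ′ *_) (𝟙-false (ρ ≟ ρ′) (ρ′≢ρ ∘ sym))) (*-zeroʳ (a k ρ′))) ⟩
  a k ρ * 𝟙 (ρ ≟ ρ)
    ≡⟨ cong (a k ρ *_) (𝟙-true (ρ ≟ ρ) refl) ⟩
  a k ρ * 1ℤ
    ≡⟨ *-identityʳ (a k ρ) ⟩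
  a k ρ ∎
  where open ≡-Reasoning

-- Permutations with prescribed cycle lengths

map-length-map : ∀ (f : A → B) xss → map length (map (map f) xss) ≡ map length xss
map-length-map f xss = trans (sym (map-∘ xss)) (map-cong (length-map f) xss)

realise : ∀ ps → All NonZero ps → ∃ λ n → ∃₂ λ (σ : Permutation′ n) css →
  Decomposition σ css × map length css ≡ ps

-- `embed` adds a new last point as a fixed point; a transposition with the previous last point then
-- joins it to the growing cycle. So `q` is the number of joins, one less than the cycle length.
realise-last : ∀ q ps → All NonZero ps → ∃ λ n → ∃₂ λ (σ : Permutation′ (suc n)) as → ∃ λ css →
  Decomposition σ ((fromℕ n ∷ as) ∷ css) × length as ≡ q × map length css ≡ ps

realise []           _         = 0 , Perm.id , [] , decomposition [] ↭-refl , refl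
realise (suc q ∷ ps) (_ ∷ pos) with n , σ , as , css , d , refl , refl ← realise-last q ps pos =
  suc n , σ , (fromℕ n ∷ as) ∷ css , d , refl

realise-last zero    ps pos with n , σ , css , d , refl ← realise ps pos =
  n , embed σ , [] , map (map inject₁) css , embed-decomposition d , refl , map-length-map inject₁ css
realise-last (suc q) ps pos with n , σ , as , css , d , refl , refl ← realise-last q ps pos =
  suc n , embed σ · transpose y (fromℕ (suc n)) , map inject₁ as ++ [ y ] , map (map inject₁) css ,
  join (embed σ) (fromℕ (suc n)) y (embed-decomposition d) ,
  trans (↭-length (++-comm (map inject₁ as) [ y ])) (cong suc (length-map inject₁ as)) ,
  map-length-map inject₁ css
  where y = inject₁ (fromℕ n)

-- Sums over blocks

-- At position `i` there are `toℕ i` entries before and `toℕ (opposite i)` after, so the positions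
-- run through all ordered pairs of lengths with the right sum.
∑ₗ-splittings : ∀ (xs : List A) {f} (g : ℕ → ℕ → ℤ) →
  (∀ ys x zs → xs ≡ ys ++ x ∷ zs → f x ≡ g (length ys) (length zs)) →
  ∑ₗ xs f ≡ ∑[ i < length xs ] g (toℕ i) (toℕ (opposite i))
∑ₗ-splittings []       g f≡g = refl
∑ₗ-splittings (x ∷ xs) g f≡g = cong₂ _+_
  (trans (f≡g [] x xs refl) (cong (g 0) (sym (Fin.toℕ-fromℕ (length xs)))))
  (trans (∑ₗ-splittings xs (g ∘ suc) (λ ys y zs eq → f≡g (x ∷ ys) y zs (cong (x ∷_) eq)))
         (sum-cong-≗ {length xs} (λ i → cong (g (suc (toℕ i))) (sym (Fin.toℕ-inject₁ (opposite i))))))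

-- Indexing by `map length xss` makes a block index literally the index of a part once the parts are
-- the block lengths.
block : (xss : List (List A)) → Fin (length (map length xss)) → List A
block (xs ∷ xss) Fin.zero    = xs
block (xs ∷ xss) (Fin.suc i) = block xss i

∑ₗ-concat : ∀ (xss : List (List A)) {f} (g : Fin (length (map length xss)) → ℤ) →
  (∀ i {x} → x ∈ block xss i → f x ≡ g i) →
  ∑ₗ (concat xss) f ≡ ∑[ i < length (map length xss) ] (+ lookup (map length xss) i * g i)
∑ₗ-concat []         g f≡g = refl
∑ₗ-concat (xs ∷ xss) g f≡g = trans (∑ₗ-++ xs (concat xss))
  (cong₂ _+_ (∑ₗ-constant xs (f≡g Fin.zero)) (∑ₗ-concat xss (g ∘ Fin.suc) (λ i → f≡g (Fin.suc i))))

extract-block : ∀ (xss : List (List A)) i → ∃ λ yss → xss ↭ block xss i ∷ yss ×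
  length (block xss i) ≡ lookup (map length xss) i × map length yss ≡ removeAt (map length xss) i
extract-block (xs ∷ xss) Fin.zero    = xss , ↭-refl , refl , refl
extract-block (xs ∷ xss) (Fin.suc i) with yss , p , eq , eqs ← extract-block xss i =
  xs ∷ yss , ↭-trans (↭.prep xs p) (↭.swap xs (block xss i) ↭-refl) , eq , cong (length xs ∷_) eqs

-- The recursion for the coefficients a k ρ

∪-↭ : ∀ ρ m .{{_ : NonZero m}} → parts (ρ ∪ m) ↭ m ∷ parts ρ
∪-↭ ρ m = sort-↭ (m ∷ parts ρ)

∖-↭ : ∀ ρ i → parts (ρ ∖ i) ↭ removeAt (parts ρ) i
∖-↭ ρ i = sort-↭ (removeAt (parts ρ) i)

module _ {σ : Permutation′ n} {x xs css} (d : Decomposition σ ((x ∷ xs) ∷ css)) where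

  cycleType-∪ : ∀ ρ → map length css ↭ parts ρ → HasCycleType σ (ρ ∪ suc (length xs))
  cycleType-∪ ρ lens = hasCycleType d (↭-trans (↭.prep _ lens) (↭-sym (∪-↭ ρ (suc (length xs)))))

  cycleType-split : ∀ ρ → map length css ↭ parts ρ → ∀ ys y zs → xs ≡ ys ++ y ∷ zs →
    HasCycleType (σ · transpose y x) (ρ ∪ suc (length ys) ∪ suc (length zs))
  cycleType-split ρ lens ys y zs refl = hasCycleType (split σ x y ys d)
    (↭-trans (↭.prep _ (↭-trans (↭.prep _ lens) (↭-sym (∪-↭ ρ (suc (length ys))))))
             (↭-sym (∪-↭ (ρ ∪ suc (length ys)) (suc (length zs)))))

  -- `join` expects `y` at the head of the second block. The block of `y` is moved to the front,
  -- rotated to start at `y`, and exchanged with the block of `x`.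
  cycleType-join : ∀ ρ i {y c css′} → css ↭ c ∷ css′ → y ∈ c → length c ≡ part ρ i →
    map length css′ ↭ removeAt (parts ρ) i → .{{_ : NonZero (part ρ i ℕ.+ suc (length xs))}} →
    HasCycleType (σ · transpose y x) (ρ ∖ i ∪ (part ρ i ℕ.+ suc (length xs)))
  cycleType-join ρ i p y∈c ∣c∣≡ lens with ys , zs , refl ← ∈-∃++ y∈c = hasCycleType
    (join σ x _ (Decomposition-resp-↭ (↭.swap _ _ ↭-refl)
      (Decomposition-rotate ys (Decomposition-resp-↭ (↭-trans (↭.prep _ p) (↭.swap _ _ ↭-refl)) d))))
    (↭-trans (↭.prep _ lens)
      (↭-trans (↭-reflexive (cong (_∷ removeAt (parts ρ) i) len))
        (↭-trans (↭.prep _ (↭-sym (∖-↭ ρ i))) (↭-sym (∪-↭ (ρ ∖ i) _)))))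
    where
    len : suc (length ((zs ++ ys) ++ _ ∷ xs)) ≡ part ρ i ℕ.+ suc (length xs)
    len = begin
      suc (length ((zs ++ ys) ++ _ ∷ xs))            ≡⟨ cong suc (length-++ (zs ++ ys)) ⟩
      suc (length (zs ++ ys)) ℕ.+ suc (length xs)    ≡⟨ cong (ℕ._+ suc (length xs)) (↭-length (++-comm (_ ∷ zs) ys)) ⟩
      length (ys ++ _ ∷ zs) ℕ.+ suc (length xs)      ≡⟨ cong (ℕ._+ suc (length xs)) ∣c∣≡ ⟩
      part ρ i ℕ.+ suc (length xs)                   ∎
      where open ≡-Reasoning

module _ (a : ℕ → Partition → ℤ) (k : ℕ) (ρ : Partition) where

  joinTerm : ∀ m .{{_ : NonZero m}} → Fin (ℓ ρ) → ℤ
  joinTerm m i = a k ((ρ ∖ i ∪ (part ρ i ℕ.+ m)) {{+-nonZeroʳ (part ρ i) m}})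

  joinSum : ∀ m .{{_ : NonZero m}} → ℤ
  joinSum m = ∑[ i < ℓ ρ ] (+ part ρ i * joinTerm m i)

  -- The argument is one less than the part being split: the two new parts add up to `suc m`.
  splitSum : ℕ → ℤ
  splitSum m = ∑[ i < m ] a k (ρ ∪ suc (toℕ i) ∪ suc (toℕ (opposite i)))

module _ a (family : IsCoefficientFamily a) (k : ℕ) where

  -- The embedded term stays unevaluated, since its value depends on whether `σ` fixes the last
  -- point. The block lengths equal the parts in the same order, so that the sum over blocks is the
  -- sum over `Fin (ℓ ρ)`.
  recursion : ∀ {σ : Permutation′ (suc n)} {xs css} → Decomposition σ ((fromℕ n ∷ xs) ∷ css) →
    ∀ ρ → map length css ≡ parts ρ →
    a (suc k) (ρ ∪ suc (length xs)) ≡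
      ⟨ hᴶ n (suc k) ∣ (λ τ → [ embed τ ≈ σ ]) ⟩
      + joinSum a k ρ (suc (length xs)) + splitSum a k ρ (length xs)
  recursion {n} {σ} {xs} {css} d ρ@(partition _ _ _) refl = begin
    a (suc k) (ρ ∪ suc (length xs))
      ≡⟨ coeff-hᴶ a family (suc k) (cycleType-∪ d ρ ↭-refl) ⟨
    coeff σ (hᴶ (suc n) (suc k))
      ≡⟨ coeff-hᴶ-suc n k σ ⟩
    E + ∑ₗ (allFin n) (λ j → F (inject₁ j))
      ≡⟨ cong (_+_ E) (∑ₗ-map inject₁ (allFin n)) ⟨
    E + ∑ₗ (map inject₁ (allFin n)) F
      ≡⟨ cong (_+_ E) (∑ₗ-↭ others) ⟨
    E + ∑ₗ (xs ++ concat css) F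
      ≡⟨ cong (_+_ E) (∑ₗ-↭ (++-comm xs (concat css))) ⟩
    E + ∑ₗ (concat css ++ xs) F
      ≡⟨ cong (_+_ E) (∑ₗ-++ (concat css) xs) ⟩
    E + (∑ₗ (concat css) F + ∑ₗ xs F)
      ≡⟨ +-assoc E _ _ ⟨
    E + ∑ₗ (concat css) F + ∑ₗ xs F
      ≡⟨ cong₂ (λ s t → E + s + t)
           (∑ₗ-concat css (joinTerm a k ρ (suc (length xs))) joined)
           (∑ₗ-splittings xs (λ r s → a k (ρ ∪ suc r ∪ suc s))
             (λ ys y zs eq → coeff-hᴶ a family k (cycleType-split d ρ ↭-refl ys y zs eq))) ⟩
    E + joinSum a k ρ (suc (length xs)) + splitSum a k ρ (length xs) ∎
    where
    open ≡-Reasoning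
    E = ⟨ hᴶ n (suc k) ∣ (λ τ → [ embed τ ≈ σ ]) ⟩
    F : Fin (suc n) → ℤ
    F j = coeff (σ · transpose j (fromℕ n)) (hᴶ (suc n) k)

    -- The last point heads its block, so removing it leaves exactly the range of `j`.
    others : xs ++ concat css ↭ map inject₁ (allFin n)
    others = drop-∷ (↭-trans (complete d)
      (↭-trans (↭-reflexive (allFin-∷ʳ n)) (↭-sym (∷↭∷ʳ (fromℕ n) _))))

    joined : ∀ i {j} → j ∈ block css i →
      F j ≡ joinTerm a k ρ (suc (length xs)) i
    joined i j∈c with css′ , p , ∣c∣≡ , lens ← extract-block css i =
      coeff-hᴶ a family k
        (cycleType-join d ρ i p j∈c ∣c∣≡ (↭-reflexive lens)
          {{+-nonZeroʳ (part ρ i) (suc (length xs))}})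

theorem2p6 : (a : ℕ → Partition → ℤ) → IsCoefficientFamily a →
    (ρ : Partition) (k m : ℕ) .{{_ : NonZero k}} .{{_ : NonZero m}} →
    a k (ρ ∪ m) ≡
    δ m 1 * a k ρ
    + (∑[ i < ℓ ρ ] (+ part ρ i * a (pred k) ((ρ ∖ i ∪ (part ρ i ℕ.+ m)) {{+-nonZeroʳ (part ρ i) m}})))
    + (∑[ i < pred m ] a (pred k) (ρ ∪ suc (toℕ i) ∪ suc (toℕ (opposite i))))
theorem2p6 a family ρ@(partition xs _ pos) (suc k) (suc zero)
  -- For `m = 1` the last point is a new fixed point. The embedded term is then the coefficient at
  -- `σ` in the smaller group, and there is nothing to split.
  with n , σ , css , d , refl ← realise xs (recompute (all? ℕ.nonZero? xs) pos)
  = trans (recursion a family k (embed-decomposition d) ρ (map-length-map inject₁ css))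
      (cong (λ e → e + joinSum a k ρ 1 + splitSum a k ρ 0) (trans (⟨∣embed≈embed⟩ (hᴶ n (suc k)) σ)
        (trans (coeff-hᴶ a family (suc k) {ρ = ρ} (hasCycleType d ↭-refl)) (sym (*-identityˡ (a (suc k) ρ))))))
theorem2p6 a family ρ@(partition xs _ pos) (suc k) (suc (suc m))
  -- For `m ≥ 2` the last point has a successor `y` in its cycle, distinct from it. The embedded
  -- term vanishes, and the `δ` term reduces to `0ℤ` by computation.
  with n , σ , y ∷ ys , css , d , refl , refl ← realise-last (suc m) xs (recompute (all? ℕ.nonZero? xs) pos)
  with (σn≡y , _) ∷ _ ← cycles d
  with (n≢y ∷ _) ∷ _ ← unique d
  = trans (recursion a family k d ρ refl)
      (cong (λ e → e + joinSum a k ρ (suc (suc m)) + splitSum a k ρ (suc m))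
        (⟨∣embed≈⟩≡0 (hᴶ n (suc k)) {σ} (λ σn≡n → n≢y (trans (sym σn≡n) σn≡y))))
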